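{- Let $p$ be a prime, $\alpha\in\mathbb{N}$, $r\in\mathbb{Z}$, and let $f(x)\in\mathbb{Z}_p[x]$ with $\deg f=l\in\mathbb{N}$. Then there is a sequence $(a_k)_{k\in\mathbb{N}}$ of $p$-adic integers such that for every $n\in\mathbb{N}$, $$\sum_{k=0}^n\binom nk(-1)^k\Big\lfloor\frac k{p^{\alpha-1}}\Big\rfloor!\binom{\{r\}_{p^{\alpha-1}}+\{k-r\}_{p^{\alpha-1}}}{\{r\}_{p^{\alpha-1}}}a_k=\begin{cases}p^lf\big(\frac{n-r}{p^{\alpha}}\big)&\text{if } n\equiv r\pmod{p^{\alpha}},\\ 0&\text{otherwise}.\end{cases}$$
   Context: For an integer $a$ and positive real $m$, $\{a\}_m$ is the unique number in $[0,m)$ with $a-\{a\}_m\in m\mathbb{Z}$ (so $\{a\}_{p^{ -1}}=0$). When $\alpha=0$, $\lfloor k/p^{ -1}\rfloor=pk$. $\mathbb{Z}_p$ denotes the $p$-adic integers. -}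

module Defs where

open import Algebra.Bundles using (CommutativeRing)
open import Algebra.Structures using (IsCommutativeRing)
open import Data.Integer.Base as ℤ using (ℤ; +_)
open import Data.Integer.Divisibility.Signed using (_∣_; divides; ∣m∣n⇒∣m+n; ∣m⇒∣-m; ∣n⇒∣m*n; ∣m⇒∣m*n)
import Data.Integer.Properties as ℤ
open import Data.Integer.Tactic.RingSolver using (solve-∀)
open import Data.List.Base using (List; []; _∷_; foldr)
open import Data.Nat.Base as ℕ using (ℕ; zero; suc)
import Data.Nat.Properties as ℕ
open import Data.Nat.Primality using (Prime; prime⇒nonZero)
open import Data.Product.Base using (_×_; _,_)
open import Level using (0ℓ)
open import Relation.Binary.PropositionalEquality using (_≡_; refl; subst)
open import Relation.Nullary.Negation using (¬_)

import Algebra.Properties.Monoid.Sum as Sum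

module PAdic (p : ℕ) where

  -- ℤₚ is the inverse limit of the rings ℤ/pⁿℤ.  The component in ℤ/pⁿℤ is
  -- given by an arbitrary integer representative, so that equality of p-adic
  -- integers is _≈_ below and not propositional equality.
  record ℤₚ : Set where
    constructor mkℤₚ
    field
      approx   : ℕ → ℤ
      coherent : ∀ n → + (p ℕ.^ n) ∣ approx (suc n) ℤ.- approx n
  open ℤₚ public

  infix 4 _≈_
  record _≈_ (x y : ℤₚ) : Set where
    constructor mk≈
    field
      congruent : ∀ n → + (p ℕ.^ n) ∣ approx x n ℤ.- approx y n
  open _≈_ public

  private
    ∣-resp : ∀ {d i j} → i ≡ j → d ∣ i → d ∣ j
    ∣-resp {d} = subst (d ∣_)

    ∣a-a : ∀ {d} a → d ∣ a ℤ.- a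
    ∣a-a a = divides (+ 0) (ℤ.+-inverseʳ a)

    +-diff : ∀ a b c e → (a ℤ.- b) ℤ.+ (c ℤ.- e) ≡ (a ℤ.+ c) ℤ.- (b ℤ.+ e)
    +-diff = solve-∀

    *-diff : ∀ a b c e → a ℤ.* (c ℤ.- e) ℤ.+ (a ℤ.- b) ℤ.* e ≡ (a ℤ.* c) ℤ.- (b ℤ.* e)
    *-diff = solve-∀

    neg-diff : ∀ a b → ℤ.- (a ℤ.- b) ≡ (ℤ.- a) ℤ.- (ℤ.- b)
    neg-diff = solve-∀

    sym-diff : ∀ a b → ℤ.- (a ℤ.- b) ≡ b ℤ.- a
    sym-diff = solve-∀

    trans-diff : ∀ a b c → (a ℤ.- b) ℤ.+ (b ℤ.- c) ≡ a ℤ.- c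
    trans-diff = solve-∀

    ∣+ : ∀ {d} a b c e → d ∣ a ℤ.- b → d ∣ c ℤ.- e → d ∣ (a ℤ.+ c) ℤ.- (b ℤ.+ e)
    ∣+ a b c e u v = ∣-resp (+-diff a b c e) (∣m∣n⇒∣m+n u v)

    ∣* : ∀ {d} a b c e → d ∣ a ℤ.- b → d ∣ c ℤ.- e → d ∣ (a ℤ.* c) ℤ.- (b ℤ.* e)
    ∣* a b c e u v = ∣-resp (*-diff a b c e) (∣m∣n⇒∣m+n (∣n⇒∣m*n a v) (∣m⇒∣m*n e u))

    ∣neg : ∀ {d} a b → d ∣ a ℤ.- b → d ∣ (ℤ.- a) ℤ.- (ℤ.- b)
    ∣neg a b u = ∣-resp (neg-diff a b) (∣m⇒∣-m u)

  fromℤ : ℤ → ℤₚ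
  fromℤ a = mkℤₚ (λ _ → a) (λ _ → ∣a-a a)

  private
    infixl 6 _⊕_
    infixl 7 _⊗_

    _⊕_ _⊗_ : ℤₚ → ℤₚ → ℤₚ
    x ⊕ y = mkℤₚ (λ n → approx x n ℤ.+ approx y n)
      (λ n → ∣+ (approx x (suc n)) _ (approx y (suc n)) _ (coherent x n) (coherent y n))
    x ⊗ y = mkℤₚ (λ n → approx x n ℤ.* approx y n)
      (λ n → ∣* (approx x (suc n)) (approx x n) (approx y (suc n)) (approx y n) (coherent x n) (coherent y n))

    ⊖_ : ℤₚ → ℤₚ
    ⊖ x = mkℤₚ (λ n → ℤ.- approx x n)
      (λ n → ∣neg (approx x (suc n)) (approx x n) (coherent x n))

    pointwise : ∀ {x y} → (∀ n → approx x n ≡ approx y n) → x ≈ y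
    pointwise {x} {y} eq = mk≈ λ n → ∣-resp (sub (eq n)) (∣a-a (approx y n))
      where
      sub : ∀ {a b} → a ≡ b → b ℤ.- b ≡ a ℤ.- b
      sub refl = refl

    isCommutativeRing : IsCommutativeRing _≈_ _⊕_ _⊗_ ⊖_ (fromℤ (+ 0)) (fromℤ (+ 1))
    isCommutativeRing = record
      { isRing = record
        { +-isAbelianGroup = record
          { isGroup = record
            { isMonoid = record
              { isSemigroup = record
                { isMagma = record
                  { isEquivalence = record
                    { refl  = pointwise λ _ → refl
                    ; sym   = λ {x} {y} u → mk≈ λ n →
                        ∣-resp (sym-diff (approx x n) (approx y n)) (∣m⇒∣-m (congruent u n))
                    ; trans = λ {x} {y} {z} u v → mk≈ λ n →
                        ∣-resp (trans-diff (approx x n) (approx y n) (approx z n))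
                               (∣m∣n⇒∣m+n (congruent u n) (congruent v n))
                    }
                  ; ∙-cong = λ {x} {y} {u} {v} e f → mk≈ λ n →
                      ∣+ (approx x n) (approx y n) (approx u n) (approx v n) (congruent e n) (congruent f n)
                  }
                ; assoc = λ x y z → pointwise λ n → ℤ.+-assoc (approx x n) (approx y n) (approx z n)
                }
              ; identity = (λ x → pointwise λ n → ℤ.+-identityˡ (approx x n))
                         , (λ x → pointwise λ n → ℤ.+-identityʳ (approx x n))
              }
            ; inverse = (λ x → pointwise λ n → ℤ.+-inverseˡ (approx x n))
                      , (λ x → pointwise λ n → ℤ.+-inverseʳ (approx x n))
            ; ⁻¹-cong = λ {x} {y} e → mk≈ λ n → ∣neg (approx x n) (approx y n) (congruent e n)
            }
          ; comm = λ x y → pointwise λ n → ℤ.+-comm (approx x n) (approx y n)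
          }
        ; *-cong = λ {x} {y} {u} {v} e f → mk≈ λ n →
            ∣* (approx x n) (approx y n) (approx u n) (approx v n) (congruent e n) (congruent f n)
        ; *-assoc = λ x y z → pointwise λ n → ℤ.*-assoc (approx x n) (approx y n) (approx z n)
        ; *-identity = (λ x → pointwise λ n → ℤ.*-identityˡ (approx x n))
                     , (λ x → pointwise λ n → ℤ.*-identityʳ (approx x n))
        ; distrib = (λ x y z → pointwise λ n → ℤ.*-distribˡ-+ (approx x n) (approx y n) (approx z n))
                  , (λ x y z → pointwise λ n → ℤ.*-distribʳ-+ (approx x n) (approx y n) (approx z n))
        }
      ; *-comm = λ x y → pointwise λ n → ℤ.*-comm (approx x n) (approx y n)
      }

  ℤₚ-commutativeRing : CommutativeRing 0ℓ 0ℓ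
  ℤₚ-commutativeRing = record { isCommutativeRing = isCommutativeRing }

  open CommutativeRing ℤₚ-commutativeRing public using (_+_; _*_; 0#; 1#; +-monoid)
  open Sum +-monoid public using (sum⁺-syntax)

  -- Coefficients in order of increasing degree; trailing zeros are allowed.
  Polynomial : Set
  Polynomial = List ℤₚ

  coeff : Polynomial → ℕ → ℤₚ
  coeff []      _       = 0#
  coeff (c ∷ _) zero    = c
  coeff (_ ∷ f) (suc i) = coeff f i

  HasDegree : Polynomial → ℕ → Set
  HasDegree f l = ¬ (coeff f l ≈ 0#) × (∀ i → l ℕ.< i → coeff f i ≈ 0#)

  eval : Polynomial → ℤₚ → ℤₚ
  eval f x = foldr (λ c v → c + x * v) 0# f

module PrimePower (p : ℕ) (p-prime : Prime p) where

  private
    instance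
      p≢0 : ℕ.NonZero p
      p≢0 = prime⇒nonZero p-prime

    p^≢0 : ∀ β → ℕ.NonZero (p ℕ.^ β)
    p^≢0 β = ℕ.m^n≢0 p β

  -- The modulus is p^(α-1), which is the fraction 1/p when α = 0: every integer
  -- is then a multiple of the modulus, and dividing by it is multiplying by p.

  ⟨_⟩p^[_-1] : ℤ → ℕ → ℕ
  ⟨ a ⟩p^[ zero  -1] = 0
  ⟨ a ⟩p^[ suc β -1] = ℤ._%ℕ_ a (p ℕ.^ β) {{p^≢0 β}}

  ⌊_/p^[_-1]⌋ : ℕ → ℕ → ℕ
  ⌊ k /p^[ zero  -1]⌋ = p ℕ.* k
  ⌊ k /p^[ suc β -1]⌋ = ℕ._/_ k (p ℕ.^ β) {{p^≢0 β}}

-- By binomial inversion aₖ exists as soon as the denominator ⌊k/pᵅ⁻¹⌋! C({r}+{k-r},{r}) divides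
-- pˡ Σ C(k,n)(-1)ⁿ f((n-r)/pᵅ), the sum over n ≡ r mod pᵅ, in ℤₚ; by linearity f = xʲ.  This sum
-- is the k-th difference at -r of the function φ_α supported on pᵅℤ with φ_α(pᵅz) = (pz)ʲ.
-- Put L_β(x) = ⌊x/p⌋ + ⋯ + ⌊x/pᵝ⌋ for x ∈ ℤ.  Legendre's formula shows that the p-adic valuation
-- of the denominator is v(k!) - L_{α-1}(r) - L_{α-1}(k-r), and the claim becomes
--   v(δᵏ φ_α (y)) ≥ v(k!) - L_{α-1}(-y) - L_{α-1}(k+y).
-- For α = 1 it is Fleck's congruence (j = 0) together with the Leibniz rule for δ (induction on j);
-- the same rule settles α = 0, where the denominator is (pk)!, up to a unit pᵏ k!.
-- For the step, let E be the shift and write (1-E)ᵖ = (1-Eᵖ) + ε, where ε is divisible by p and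
-- involves only shifts by 0, …, p.  Expanding (1-E)ⁿ with n = pN + n₀ gives the terms
-- C(N,i) (1-E)^{n₀} εⁱ (1-Eᵖ)^{N-i}, and (1-Eᵖ)^{N-i} φ_{α+1} is δ^{N-i} φ_α on pℤ, 0 off pℤ.
module Submission where

open import Defs
open import Algebra.Bundles using (CommutativeRing)
open import Data.Fin.Base as Fin using (Fin; toℕ)
open import Data.Integer.Base as ℤ using (ℤ; +_; -1ℤ)
open import Data.Integer.DivMod using (n<s[n/ℕd]*d; [n/ℕd]*d≤n; a≡a%ℕn+[a/ℕn]*n; n%ℕd<d)
open import Data.Integer.Divisibility.Signed using (_∣_; divides; quotient; _∣?_; ∣-refl; ∣-trans; ∣m∣n⇒∣m+n; ∣m+n∣n⇒∣m; ∣n⇒∣m*n; *-cancelˡ-∣; ∣ᵤ⇒∣)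
open import Data.Integer.Tactic.RingSolver using (solve-∀)
open import Data.List.Base using (List; []; _∷_; foldr; drop)
open import Data.List.Relation.Unary.All using (All; []; _∷_)
open import Data.Nat.Base as ℕ using (ℕ; zero; suc; _!)
open import Data.Nat.Combinatorics using (_C_; nCn≡1; k>n⇒nCk≡0; nCk+nC[k+1]≡[n+1]C[k+1]; nCk≡n!/k![n-k]!; k![n∸k]!∣n!)
open import Data.Nat.Coprimality using (Coprime; coprime-Bézout)
open import Data.Nat.GCD using (module Bézout)
open import Data.Nat.Induction using (<-rec)
open import Data.Nat.Primality using (Prime; euclidsLemma; prime⇒nonZero; prime⇒nonTrivial; prime⇒irreducible)
open import Data.Product.Base using (Σ-syntax; ∃-syntax; _×_; _,_; proj₁; proj₂)
open import Data.Sum.Base using (inj₁; inj₂; [_,_]′)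
open import Function.Base using (_∘_)
open import Level using (0ℓ)
open import Relation.Binary.Bundles using (Preorder)
open import Relation.Binary.PropositionalEquality
open import Relation.Nullary.Decidable.Core using (yes; no)
open import Relation.Nullary.Negation using (¬_; contradiction)

import Algebra.Properties.Semiring.Sum as SemiringSum
import Data.Fin.Properties as Fin
import Data.Integer.Properties as ℤ
import Data.Nat.Divisibility as ℕ
import Data.Nat.DivMod as ℕ
import Data.Nat.Properties as ℕ
import Data.Nat.Tactic.RingSolver as ℕSolver
import Data.Vec.Functional as Vector
import Relation.Binary.Reasoning.Preorder as PreorderReasoning
import Relation.Binary.Reasoning.Setoid as SetoidReasoning

-- Divisibility in the integers localised at p, and the p-part of factorials.

module Valuation (p : ℕ) (p-prime : Prime p) where
  open import Data.Integer.Base using (_+_; _*_; _-_; -_)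

  instance
    p-nonZero : ℕ.NonZero p
    p-nonZero = prime⇒nonZero p-prime

  p-nonTrivial : ℕ.NonTrivial p
  p-nonTrivial = prime⇒nonTrivial p-prime

  2≤p : 2 ℕ.≤ p
  2≤p = ℕ.nonTrivial⇒n>1 p {{p-nonTrivial}}

  ∤-* : ∀ {u v} → p ℕ.∤ u → p ℕ.∤ v → p ℕ.∤ u ℕ.* v
  ∤-* {u} {v} p∤u p∤v p∣uv = [ p∤u , p∤v ]′ (euclidsLemma u v p-prime p∣uv)

  ∤-1 : p ℕ.∤ 1
  ∤-1 p∣1 = ℕ.>⇒∤ 2≤p p∣1

  -- Divisibility in the localisation of ℤ at p.
  infix 4 _∣ₚ_
  record _∣ₚ_ (d x : ℤ) : Set where
    constructor mk∣ₚ
    field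
      unit     : ℕ
      unit-∤   : p ℕ.∤ unit
      multiple : d ∣ + unit * x

  ∣⇒∣ₚ : ∀ {d x} → d ∣ x → d ∣ₚ x
  ∣⇒∣ₚ {d} d∣x = mk∣ₚ 1 ∤-1 (subst (d ∣_) (sym (ℤ.*-identityˡ _)) d∣x)

  ∣ₚ-refl : ∀ {x} → x ∣ₚ x
  ∣ₚ-refl = ∣⇒∣ₚ ∣-refl

  ∣ₚ-reflexive : ∀ {x y} → x ≡ y → x ∣ₚ y
  ∣ₚ-reflexive refl = ∣ₚ-refl

  *-mono-∣ : ∀ {d e x y} → d ∣ x → e ∣ y → d * e ∣ x * y
  *-mono-∣ {d} {e} (divides q refl) (divides s refl) = divides (q * s) (lemma q d s e)
    where
    lemma : ∀ q d s e → q * d * (s * e) ≡ q * s * (d * e)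
    lemma = solve-∀

  ∣ₚ-trans : ∀ {x y z} → x ∣ₚ y → y ∣ₚ z → x ∣ₚ z
  ∣ₚ-trans {x} {y} {z} (mk∣ₚ u p∤u x∣uy) (mk∣ₚ v p∤v y∣vz) =
    mk∣ₚ (u ℕ.* v) (∤-* p∤u p∤v) (∣-trans x∣uy (subst (+ u * y ∣_) eq (*-mono-∣ (∣-refl {+ u}) y∣vz)))
    where
    eq : + u * (+ v * z) ≡ + (u ℕ.* v) * z
    eq = trans (sym (ℤ.*-assoc (+ u) (+ v) z)) (cong (_* z) (sym (ℤ.pos-* u v)))

  ∣ₚ-preorder : Preorder 0ℓ 0ℓ 0ℓ
  ∣ₚ-preorder = record
    { _≈_ = _≡_
    ; _≲_ = _∣ₚ_
    ; isPreorder = record { isEquivalence = isEquivalence ; reflexive = ∣ₚ-reflexive ; trans = ∣ₚ-trans }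
    }

  module ∣ₚ-Reasoning = PreorderReasoning ∣ₚ-preorder

  *-mono-∣ₚ : ∀ {d e x y} → d ∣ₚ x → e ∣ₚ y → d * e ∣ₚ x * y
  *-mono-∣ₚ {d} {e} {x} {y} (mk∣ₚ u p∤u d∣ux) (mk∣ₚ v p∤v e∣vy) =
    mk∣ₚ (u ℕ.* v) (∤-* p∤u p∤v) (subst (d * e ∣_) eq (*-mono-∣ d∣ux e∣vy))
    where
    swap : ∀ u v x y → u * x * (v * y) ≡ u * v * (x * y)
    swap = solve-∀
    eq : + u * x * (+ v * y) ≡ + (u ℕ.* v) * (x * y)
    eq = trans (swap (+ u) (+ v) x y) (cong (_* (x * y)) (sym (ℤ.pos-* u v)))

  *-monoʳ-∣ₚ : ∀ z {d x} → d ∣ₚ x → z * d ∣ₚ z * x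
  *-monoʳ-∣ₚ z = *-mono-∣ₚ (∣ₚ-refl {z})

  *-monoˡ-∣ₚ : ∀ z {d x} → d ∣ₚ x → d * z ∣ₚ x * z
  *-monoˡ-∣ₚ z d∣x = *-mono-∣ₚ d∣x (∣ₚ-refl {z})

  ∣ₚn⇒∣ₚm*n : ∀ {d} z {x} → d ∣ₚ x → d ∣ₚ z * x
  ∣ₚn⇒∣ₚm*n z d∣x = ∣ₚ-trans d∣x (∣⇒∣ₚ (divides z refl))

  ∣ₚ0 : ∀ {d} → d ∣ₚ + 0
  ∣ₚ0 = ∣⇒∣ₚ (divides (+ 0) refl)

  ∣ₚ-+ : ∀ {d x y} → d ∣ₚ x → d ∣ₚ y → d ∣ₚ x + y
  ∣ₚ-+ {d} {x} {y} (mk∣ₚ u p∤u d∣ux) (mk∣ₚ v p∤v d∣vy) =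
    mk∣ₚ (u ℕ.* v) (∤-* p∤u p∤v)
      (subst (d ∣_) eq (∣m∣n⇒∣m+n (∣n⇒∣m*n (+ v) d∣ux) (∣n⇒∣m*n (+ u) d∣vy)))
    where
    expand : ∀ u v x y → v * (u * x) + u * (v * y) ≡ u * v * (x + y)
    expand = solve-∀
    eq : + v * (+ u * x) + + u * (+ v * y) ≡ + (u ℕ.* v) * (x + y)
    eq = trans (expand (+ u) (+ v) x y) (cong (_* (x + y)) (sym (ℤ.pos-* u v)))

  ∣ₚ-neg : ∀ {d x} → d ∣ₚ x → d ∣ₚ - x
  ∣ₚ-neg {d} {x} d∣x = subst (d ∣ₚ_) (ℤ.-1*i≡-i x) (∣ₚn⇒∣ₚm*n -1ℤ d∣x)

  ∣ₚ-- : ∀ {d x y} → d ∣ₚ x → d ∣ₚ y → d ∣ₚ x - y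
  ∣ₚ-- d∣x d∣y = ∣ₚ-+ d∣x (∣ₚ-neg d∣y)

  *-cancelˡ-∣ₚ : ∀ z .{{_ : ℤ.NonZero z}} {d x} → z * d ∣ₚ z * x → d ∣ₚ x
  *-cancelˡ-∣ₚ z {d} {x} (mk∣ₚ u p∤u zd∣uzx) =
    mk∣ₚ u p∤u (*-cancelˡ-∣ z (subst (z * d ∣_) (swap (+ u) z x) zd∣uzx))
    where
    swap : ∀ u z x → u * (z * x) ≡ z * (u * x)
    swap = solve-∀

  open SemiringSum ℤ.+-*-semiring using (sum)

  ∣ₚ-sum : ∀ {d n} (t : Fin n → ℤ) → (∀ i → d ∣ₚ t i) → d ∣ₚ sum t
  ∣ₚ-sum {n = zero}  t d∣t = ∣ₚ0
  ∣ₚ-sum {n = suc n} t d∣t = ∣ₚ-+ (d∣t Fin.zero) (∣ₚ-sum (t ∘ Fin.suc) (d∣t ∘ Fin.suc))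

  ⟦_⟧! : ℕ → ℤ
  ⟦ n ⟧! = + (n !)

  π^_ : ℕ → ℤ
  π^ n = + (p ℕ.^ n)

  π^-+ : ∀ m n → π^ (m ℕ.+ n) ≡ π^ m * π^ n
  π^-+ m n = trans (cong +_ (ℕ.^-distribˡ-+-* p m n)) (ℤ.pos-* (p ℕ.^ m) (p ℕ.^ n))

  π^-mono : ∀ {m n} → m ℕ.≤ n → π^ m ∣ₚ π^ n
  π^-mono {m} {n} m≤n = ∣⇒∣ₚ (divides (π^ (n ℕ.∸ m))
    (trans (cong π^_ (sym (ℕ.m∸n+n≡m m≤n))) (π^-+ (n ℕ.∸ m) m)))

  -- Among 1, ..., j + mp the multiples of p are p, 2p, ..., mp, with product p^m m!; the other
  -- factors make up `u`. For j = 0 and m > 0 the recursion passes to m - 1 with the largest digit p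
  -- - 1, splitting off the factor mp.
  factorial-digit : ∀ m j → j ℕ.< p → ∃[ u ] p ℕ.∤ u × (j ℕ.+ m ℕ.* p) ! ≡ u ℕ.* (p ℕ.^ m ℕ.* m !)
  factorial-digit zero zero _ = 1 , ∤-1 , refl
  factorial-digit (suc m) zero _ with factorial-digit m (ℕ.pred p) (ℕ.≤-reflexive (ℕ.suc-pred p))
  ... | u , p∤u , eq = u , p∤u , (begin
      (p ℕ.+ m ℕ.* p) !                                   ≡⟨ cong (λ q → (q ℕ.+ m ℕ.* p) !) (ℕ.suc-pred p) ⟨
      suc (ℕ.pred p ℕ.+ m ℕ.* p) ℕ.* (ℕ.pred p ℕ.+ m ℕ.* p) ! ≡⟨ cong₂ ℕ._*_ (cong (ℕ._+ m ℕ.* p) (ℕ.suc-pred p)) eq ⟩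
      (p ℕ.+ m ℕ.* p) ℕ.* (u ℕ.* (p ℕ.^ m ℕ.* m !))        ≡⟨ regroup p m u (p ℕ.^ m) (m !) ⟩
      u ℕ.* (p ℕ.* p ℕ.^ m ℕ.* (m ! ℕ.+ m ℕ.* m !))        ∎)
    where
    open ≡-Reasoning
    regroup : ∀ p m u q f → (p ℕ.+ m ℕ.* p) ℕ.* (u ℕ.* (q ℕ.* f)) ≡ u ℕ.* (p ℕ.* q ℕ.* (f ℕ.+ m ℕ.* f))
    regroup = ℕSolver.solve-∀
  factorial-digit m (suc j) 1+j<p with factorial-digit m j (ℕ.<-trans (ℕ.n<1+n j) 1+j<p)
  ... | u , p∤u , eq = suc (j ℕ.+ m ℕ.* p) ℕ.* u
      , ∤-* (λ p∣ → ℕ.>⇒∤ 1+j<p (ℕ.∣m+n∣m⇒∣n (subst (p ℕ.∣_) (ℕ.+-comm (suc j) (m ℕ.* p)) p∣) (ℕ.n∣m*n m))) p∤u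
      , trans (cong (suc (j ℕ.+ m ℕ.* p) ℕ.*_) eq) (sym (ℕ.*-assoc (suc (j ℕ.+ m ℕ.* p)) u _))

  module _ (n : ℕ) where
    private
      digit : ∃[ u ] p ℕ.∤ u × n ! ≡ u ℕ.* (p ℕ.^ (n ℕ./ p) ℕ.* (n ℕ./ p) !)
      digit = subst (λ m → ∃[ u ] p ℕ.∤ u × m ! ≡ u ℕ.* (p ℕ.^ (n ℕ./ p) ℕ.* (n ℕ./ p) !))
        (sym (ℕ.m≡m%n+[m/n]*n n p)) (factorial-digit (n ℕ./ p) (n ℕ.% p) (ℕ.m%n<n n p))

      factor : ⟦ n ⟧! ≡ + proj₁ digit * (π^ (n ℕ./ p) * ⟦ n ℕ./ p ⟧!)
      factor = trans (cong +_ (proj₂ (proj₂ digit)))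
        (trans (ℤ.pos-* (proj₁ digit) _) (cong (+ proj₁ digit *_) (ℤ.pos-* (p ℕ.^ (n ℕ./ p)) _)))

    -- The prime-to-p cofactor of n! has to be inverted here, which the localisation permits; the
    -- converse `π^*!∣ₚ!` is a division of integers. Together they give v(n!) = ⌊n/p⌋ + v(⌊n/p⌋!).
    !∣ₚπ^*! : ⟦ n ⟧! ∣ₚ π^ (n ℕ./ p) * ⟦ n ℕ./ p ⟧!
    !∣ₚπ^*! = mk∣ₚ (proj₁ digit) (proj₁ (proj₂ digit)) (divides (+ 1) (trans (sym factor) (sym (ℤ.*-identityˡ _))))

    π^*!∣ₚ! : π^ (n ℕ./ p) * ⟦ n ℕ./ p ⟧! ∣ₚ ⟦ n ⟧!
    π^*!∣ₚ! = ∣⇒∣ₚ (divides (+ proj₁ digit) factor)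

  -- With m = ⌊n/p⌋ ≤ n/2, induction gives v(n!) = m + v(m!) ≤ m + (m - 1) ≤ n - 1 when m > 0. The 1
  -- saved for n > 0 is consumed in `N+[i∸1]≤R+M+i`.
  !∣ₚπ^[n∸1] : ∀ n → ⟦ n ⟧! ∣ₚ π^ (n ℕ.∸ 1)
  !∣ₚπ^[n∸1] = <-rec _ step
    where
    open ∣ₚ-Reasoning
    step : ∀ n → (∀ {m} → m ℕ.< n → ⟦ m ⟧! ∣ₚ π^ (m ℕ.∸ 1)) → ⟦ n ⟧! ∣ₚ π^ (n ℕ.∸ 1)
    step zero    _   = ∣ₚ-refl
    step n@(suc n-1) rec = begin
      ⟦ n ⟧!                                    ≲⟨ !∣ₚπ^*! n ⟩
      π^ (n ℕ./ p) * ⟦ n ℕ./ p ⟧!               ≲⟨ *-monoʳ-∣ₚ (π^ (n ℕ./ p)) (rec (ℕ.m/n<m n p 2≤p)) ⟩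
      π^ (n ℕ./ p) * π^ (n ℕ./ p ℕ.∸ 1)         ≡⟨ π^-+ (n ℕ./ p) (n ℕ./ p ℕ.∸ 1) ⟨
      π^ (n ℕ./ p ℕ.+ (n ℕ./ p ℕ.∸ 1))          ≲⟨ π^-mono (bound (n ℕ./ p) m*2≤n) ⟩
      π^ n-1                                    ∎
      where
      m*2≤n : n ℕ./ p ℕ.* 2 ℕ.≤ n
      m*2≤n = ℕ.≤-trans (ℕ.*-monoʳ-≤ (n ℕ./ p) 2≤p) (ℕ.m/n*n≤m n p)

      bound : ∀ m → m ℕ.* 2 ℕ.≤ suc n-1 → m ℕ.+ (m ℕ.∸ 1) ℕ.≤ n-1
      bound zero    _ = ℕ.z≤n
      bound (suc m) (ℕ.s≤s le) = subst (ℕ._≤ n-1) (double m) le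
        where
        double : ∀ m → suc (m ℕ.* 2) ≡ suc m ℕ.+ m
        double = ℕSolver.solve-∀

-- Powers of the difference operator 1 - E and binomial expansions.

module Difference where
  open import Data.Integer.Base using (_+_; _*_; _-_; -_; _^_)
  open SemiringSum ℤ.+-*-semiring using (sum⁺-syntax; sum-cong-≗; sum-init-last; ∑-distrib-+)

  -- The power (1 - E)^n for the shift E. With this sign, unlike that of E - 1, expansion and
  -- inversion are the same alternating sum.
  δ : ℕ → (ℤ → ℤ) → ℤ → ℤ
  δ zero    ψ y = ψ y
  δ (suc n) ψ y = δ n ψ y - δ n ψ (y + + 1)

  δ-cong : ∀ n {ψ χ} → (∀ x → ψ x ≡ χ x) → ∀ y → δ n ψ y ≡ δ n χ y
  δ-cong zero    ψ≗χ y = ψ≗χ y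
  δ-cong (suc n) ψ≗χ y = cong₂ _-_ (δ-cong n ψ≗χ y) (δ-cong n ψ≗χ (y + + 1))

  δ-+ : ∀ n ψ χ y → δ n (λ x → ψ x + χ x) y ≡ δ n ψ y + δ n χ y
  δ-+ zero    ψ χ y = refl
  δ-+ (suc n) ψ χ y = trans (cong₂ _-_ (δ-+ n ψ χ y) (δ-+ n ψ χ (y + + 1))) (interchange (δ n ψ y) _ _ _)
    where
    interchange : ∀ a b c d → (a + b) - (c + d) ≡ (a - c) + (b - d)
    interchange = solve-∀

  δ-- : ∀ n ψ χ y → δ n (λ x → ψ x - χ x) y ≡ δ n ψ y - δ n χ y
  δ-- zero    ψ χ y = refl
  δ-- (suc n) ψ χ y = trans (cong₂ _-_ (δ-- n ψ χ y) (δ-- n ψ χ (y + + 1))) (interchange (δ n ψ y) _ _ _)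
    where
    interchange : ∀ a b c d → (a - b) - (c - d) ≡ (a - c) - (b - d)
    interchange = solve-∀

  δ-scale : ∀ n c ψ y → δ n (λ x → c * ψ x) y ≡ c * δ n ψ y
  δ-scale zero    c ψ y = refl
  δ-scale (suc n) c ψ y = trans (cong₂ _-_ (δ-scale n c ψ y) (δ-scale n c ψ (y + + 1)))
    (factor c (δ n ψ y) (δ n ψ (y + + 1)))
    where
    factor : ∀ c a b → c * a - c * b ≡ c * (a - b)
    factor = solve-∀

  δ-shift : ∀ n ψ k y → δ n (λ x → ψ (x + k)) y ≡ δ n ψ (y + k)
  δ-shift zero    ψ k y = refl
  δ-shift (suc n) ψ k y = cong₂ _-_ (δ-shift n ψ k y)
    (trans (δ-shift n ψ k (y + + 1)) (cong (δ n ψ) (swap y (+ 1) k)))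
    where
    swap : ∀ y j k → y + j + k ≡ y + k + j
    swap = solve-∀

  δ-δ : ∀ m n ψ y → δ m (δ n ψ) y ≡ δ (m ℕ.+ n) ψ y
  δ-δ zero    n ψ y = refl
  δ-δ (suc m) n ψ y = cong₂ _-_ (δ-δ m n ψ y) (δ-δ m n ψ (y + + 1))

  δ-const : ∀ n c y → δ (suc n) (λ _ → c) y ≡ + 0
  δ-const zero    c y = ℤ.+-inverseʳ c
  δ-const (suc n) c y = cong₂ _-_ (δ-const n c y) (δ-const n c (y + + 1))

  -- Moving multiplication by x to the left past a factor 1 - E leaves a term -E, and each of the n
  -- + 1 factors contributes one.
  δ-leibniz : ∀ n ψ y → δ (suc n) (λ x → x * ψ x) y ≡ y * δ (suc n) ψ y - + suc n * δ n ψ (y + + 1)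
  δ-leibniz zero ψ y = base y (ψ y) (ψ (y + + 1))
    where
    base : ∀ y a b → y * a - (y + + 1) * b ≡ y * (a - b) - + 1 * b
    base = solve-∀
  δ-leibniz (suc n) ψ y = trans (cong₂ _-_ (δ-leibniz n ψ y) (δ-leibniz n ψ (y + + 1)))
    (step y (δ (suc n) ψ y) (δ n ψ (y + + 1)) (δ n ψ (y + + 1 + + 1)) (+ suc n))
    where
    step : ∀ y a c d m → (y * a - m * c) - ((y + + 1) * (c - d) - m * d) ≡ y * (a - (c - d)) - (+ 1 + m) * (c - d)
    step = solve-∀

  pascal-sum : ∀ n (s : ℕ → ℤ) →
    ∑[ k ≤ suc n ] (+ (suc n C toℕ k) * s (toℕ k)) ≡
    ∑[ k ≤ n ] (+ (n C toℕ k) * s (suc (toℕ k))) + ∑[ k ≤ n ] (+ (n C toℕ k) * s (toℕ k))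
  pascal-sum n s = begin
    + 1 * s 0 + ∑[ k ≤ n ] (+ (suc n C suc (toℕ k)) * s (suc (toℕ k)))
      ≡⟨ cong (_+_ (+ 1 * s 0)) (trans (sum-cong-≗ {suc n} term) (∑-distrib-+ {suc n} (λ k → + (n C toℕ k) * s (suc (toℕ k))) (λ k → t (suc (toℕ k))))) ⟩
    + 1 * s 0 + (a + ∑[ k ≤ n ] t (suc (toℕ k)))
      -- The term k = 0 joins the second sum, which then runs to n + 1; its last term has the
      -- coefficient C(n, n + 1) = 0 and is dropped.
      ≡⟨ swap (+ 1 * s 0) a _ ⟩
    a + ∑[ k ≤ suc n ] t (toℕ k)
      ≡⟨ cong (_+_ a) (sum-init-last {suc n} (λ k → t (toℕ k))) ⟩
    a + (∑[ k ≤ n ] t (toℕ (Fin.inject₁ k)) + t (toℕ (Fin.fromℕ (suc n))))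
      ≡⟨ cong₂ (λ b c → a + (b + c)) (sum-cong-≗ {suc n} (λ k → cong t (Fin.toℕ-inject₁ k))) last≡0 ⟩
    a + (∑[ k ≤ n ] t (toℕ k) + + 0)
      ≡⟨ cong (_+_ a) (ℤ.+-identityʳ _) ⟩
    a + ∑[ k ≤ n ] t (toℕ k) ∎
    where
    open ≡-Reasoning
    t : ℕ → ℤ
    t k = + (n C k) * s k

    a : ℤ
    a = ∑[ k ≤ n ] (+ (n C toℕ k) * s (suc (toℕ k)))

    term : ∀ (k : Fin (suc n)) → + (suc n C suc (toℕ k)) * s (suc (toℕ k)) ≡
      + (n C toℕ k) * s (suc (toℕ k)) + + (n C suc (toℕ k)) * s (suc (toℕ k))
    term k = trans (cong (λ c → + c * s (suc (toℕ k))) (sym (nCk+nC[k+1]≡[n+1]C[k+1] n (toℕ k))))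
      (ℤ.*-distribʳ-+ (s (suc (toℕ k))) (+ (n C toℕ k)) (+ (n C suc (toℕ k))))

    swap : ∀ x y z → x + (y + z) ≡ y + (x + z)
    swap = solve-∀

    last≡0 : t (toℕ (Fin.fromℕ (suc n))) ≡ + 0
    last≡0 = trans (cong t (Fin.toℕ-fromℕ (suc n))) (cong (λ c → + c * s (suc n)) (k>n⇒nCk≡0 (ℕ.n<1+n n)))

  -- The binomial theorem for commuting operators with X = Y + Z: entry (n, i) is X^n Y^i Z^(N - n -
  -- i), or X^n Y^i when Z = 1. The bound N serves `δ-digit-expansion`, where the exponent of Z must
  -- not become negative.
  pascal-array : ∀ N (w : ℕ → ℕ → ℤ) →
    (∀ n i → n ℕ.+ i ℕ.< N → w (suc n) i ≡ w n (suc i) + w n i) →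
    ∀ n i → n ℕ.+ i ℕ.≤ N → w n i ≡ ∑[ k ≤ n ] (+ (n C toℕ k) * w 0 (toℕ k ℕ.+ i))
  pascal-array N w rule zero    i _  = sym (trans (ℤ.+-identityʳ _) (ℤ.*-identityˡ (w 0 i)))
  pascal-array N w rule (suc n) i le = begin
    w (suc n) i
      ≡⟨ rule n i le ⟩
    w n (suc i) + w n i
      ≡⟨ cong₂ _+_ (pascal-array N w rule n (suc i) (subst (ℕ._≤ N) (sym (ℕ.+-suc n i)) le))
                   (pascal-array N w rule n i (ℕ.<⇒≤ le)) ⟩
    ∑[ k ≤ n ] (+ (n C toℕ k) * w 0 (toℕ k ℕ.+ suc i)) + ∑[ k ≤ n ] (+ (n C toℕ k) * w 0 (toℕ k ℕ.+ i))
      ≡⟨ cong (_+ ∑[ k ≤ n ] (+ (n C toℕ k) * w 0 (toℕ k ℕ.+ i))) (sum-cong-≗ {suc n} (λ k → cong (λ j → + (n C toℕ k) * w 0 j) (ℕ.+-suc (toℕ k) i))) ⟩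
    ∑[ k ≤ n ] (+ (n C toℕ k) * w 0 (suc (toℕ k) ℕ.+ i)) + ∑[ k ≤ n ] (+ (n C toℕ k) * w 0 (toℕ k ℕ.+ i))
      ≡⟨ pascal-sum n (λ k → w 0 (k ℕ.+ i)) ⟨
    ∑[ k ≤ suc n ] (+ (suc n C toℕ k) * w 0 (toℕ k ℕ.+ i)) ∎
    where open ≡-Reasoning

  private
    alternate : ∀ e a b → e * (a - b) ≡ -1ℤ * e * b + e * a
    alternate = solve-∀

    y+[1+k] : ∀ y k → y + (+ 1 + k) ≡ y + k + + 1
    y+[1+k] = solve-∀

  δ-expansion : ∀ n ψ y → δ n ψ y ≡ ∑[ k ≤ n ] (+ (n C toℕ k) * (-1ℤ ^ toℕ k * ψ (y + + toℕ k)))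
  δ-expansion n ψ y = begin
    δ n ψ y
      ≡⟨ trans (ℤ.*-identityˡ _) (cong (δ n ψ) (ℤ.+-identityʳ y)) ⟨
    w n 0
      ≡⟨ pascal-array (n ℕ.+ 0) w rule n 0 ℕ.≤-refl ⟩
    ∑[ k ≤ n ] (+ (n C toℕ k) * w 0 (toℕ k ℕ.+ 0))
      ≡⟨ sum-cong-≗ {suc n} (λ k → cong (λ j → + (n C toℕ k) * w 0 j) (ℕ.+-identityʳ (toℕ k))) ⟩
    ∑[ k ≤ n ] (+ (n C toℕ k) * w 0 (toℕ k)) ∎
    where
    open ≡-Reasoning
    -- The entry is (-E)^i (1 - E)^m ψ at y; the rule is 1 - E = -E + 1.
    w : ℕ → ℕ → ℤ
    w m i = -1ℤ ^ i * δ m ψ (y + + i)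

    rule : ∀ m i → m ℕ.+ i ℕ.< n ℕ.+ 0 → w (suc m) i ≡ w m (suc i) + w m i
    rule m i _ = trans (alternate (-1ℤ ^ i) _ _)
      (cong (λ x → -1ℤ ^ suc i * δ m ψ x + w m i) (sym (y+[1+k] y (+ i))))

  δ-inversion : ∀ n ψ y → ψ (y + + n) ≡ ∑[ k ≤ n ] (+ (n C toℕ k) * (-1ℤ ^ toℕ k * δ (toℕ k) ψ y))
  δ-inversion n ψ y = begin
    ψ (y + + n)
      ≡⟨ ℤ.*-identityˡ _ ⟨
    w n 0
      ≡⟨ pascal-array (n ℕ.+ 0) w rule n 0 ℕ.≤-refl ⟩
    ∑[ k ≤ n ] (+ (n C toℕ k) * w 0 (toℕ k ℕ.+ 0))
      ≡⟨ sum-cong-≗ {suc n} (λ k → cong (+ (n C toℕ k) *_) (trans (cong (w 0) (ℕ.+-identityʳ (toℕ k)))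
           (cong (λ x → -1ℤ ^ toℕ k * δ (toℕ k) ψ x) (ℤ.+-identityʳ y)))) ⟩
    ∑[ k ≤ n ] (+ (n C toℕ k) * (-1ℤ ^ toℕ k * δ (toℕ k) ψ y)) ∎
    where
    open ≡-Reasoning
    -- The entry is E^m (-(1 - E))^i ψ at y; the rule is E = -(1 - E) + 1.
    w : ℕ → ℕ → ℤ
    w m i = -1ℤ ^ i * δ i ψ (y + + m)

    telescope : ∀ e a b → e * b ≡ -1ℤ * e * (a - b) + e * a
    telescope = solve-∀

    rule : ∀ m i → m ℕ.+ i ℕ.< n ℕ.+ 0 → w (suc m) i ≡ w m (suc i) + w m i
    rule m i _ = trans (cong (λ x → -1ℤ ^ i * δ i ψ x) (y+[1+k] y (+ m)))
      (telescope (-1ℤ ^ i) (δ i ψ (y + + m)) (δ i ψ (y + + m + + 1)))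

-- Divisibility of differences: Fleck's congruence and the Leibniz rule.

module DifferenceDivisibility (p : ℕ) (p-prime : Prime p) where
  open import Data.Integer.Base using (_+_; _*_; _-_; -_; _^_)
  open Valuation p p-prime
  open Difference
  open SemiringSum ℤ.+-*-semiring using (sum⁺-syntax; sum-cong-≗; ∑-distrib-+)

  C*!*! : ∀ {n k} → k ℕ.≤ n → (n C k) ℕ.* (k ! ℕ.* (n ℕ.∸ k) !) ≡ n !
  C*!*! {n} {k} k≤n = trans (cong (ℕ._* (k ! ℕ.* (n ℕ.∸ k) !)) (nCk≡n!/k![n-k]! k≤n))
    (ℕ.m/n*n≡m {{ℕ._!*_!≢0 k (n ℕ.∸ k)}} (k![n∸k]!∣n! k≤n))

  ∤-! : ∀ {j} → j ℕ.< p → p ℕ.∤ j !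
  ∤-! {zero}  _      = ∤-1
  ∤-! {suc j} 1+j<p = ∤-* (ℕ.>⇒∤ 1+j<p) (∤-! (ℕ.<⇒≤ 1+j<p))

  p∣p! : p ℕ.∣ p !
  p∣p! = subst (λ q → q ℕ.∣ q !) (ℕ.suc-pred p) (ℕ.m∣m*n (ℕ.pred p !))

  p∣pCk : ∀ {k} → 0 ℕ.< k → k ℕ.< p → p ℕ.∣ p C k
  p∣pCk {k} 0<k k<p with euclidsLemma (p C k) (k ! ℕ.* (p ℕ.∸ k) !) p-prime
      (subst (p ℕ.∣_) (sym (C*!*! (ℕ.<⇒≤ k<p))) p∣p!)
  ... | inj₁ p∣C = p∣C
  ... | inj₂ p∣! = contradiction p∣! (∤-* (∤-! k<p) (∤-! (ℕ.∸-monoʳ-< 0<k (ℕ.<⇒≤ k<p))))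

  -- The multiplier `z` is carried along because in the application d divides only after
  -- multiplication by some p^c. The hypothesis is restricted to y, ..., y + n since the
  -- divisibility supplied there depends on the position.
  δ-∣ₚ : ∀ {d} z n ψ y → (∀ s → s ℕ.≤ n → d ∣ₚ z * ψ (y + + s)) → d ∣ₚ z * δ n ψ y
  δ-∣ₚ {d} z zero    ψ y d∣zψ = subst (λ x → d ∣ₚ z * ψ x) (ℤ.+-identityʳ y) (d∣zψ 0 ℕ.z≤n)
  δ-∣ₚ {d} z (suc n) ψ y d∣zψ = subst (d ∣ₚ_) (sym (factor z (δ n ψ y) (δ n ψ (y + + 1))))
    (∣ₚ-- (δ-∣ₚ z n ψ y (λ s s≤n → d∣zψ s (ℕ.m≤n⇒m≤1+n s≤n)))
          (δ-∣ₚ z n ψ (y + + 1) (λ s s≤n → subst (λ x → d ∣ₚ z * ψ x) (sym (ℤ.+-assoc y (+ 1) (+ s))) (d∣zψ (suc s) (ℕ.s≤s s≤n)))))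
    where
    factor : ∀ z a b → z * (a - b) ≡ z * a - z * b
    factor = solve-∀

  δ-∣ₚ-everywhere : ∀ {d} n ψ → (∀ x → d ∣ₚ ψ x) → ∀ y → d ∣ₚ δ n ψ y
  δ-∣ₚ-everywhere zero    ψ d∣ψ y = d∣ψ y
  δ-∣ₚ-everywhere (suc n) ψ d∣ψ y = ∣ₚ-- (δ-∣ₚ-everywhere n ψ d∣ψ y) (δ-∣ₚ-everywhere n ψ d∣ψ (y + + 1))

  -- Neighbours C(p-1, k) and C(p-1, k+1) add up to C(p, k+1), a multiple of p, so modulo p the
  -- values alternate in sign, starting at 1.
  C[p-1]-alternating : ∀ k → k ℕ.< p → + p ∣ + (ℕ.pred p C k) * -1ℤ ^ k - + 1
  C[p-1]-alternating zero    _     = divides (+ 0) refl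
  C[p-1]-alternating (suc k) 1+k<p = subst (+ p ∣_) eq
      (∣m∣n⇒∣m+n (∣n⇒∣m*n (- (-1ℤ ^ k)) (∣ᵤ⇒∣ (p∣pCk ℕ.z<s 1+k<p)))
                 (C[p-1]-alternating k (ℕ.<⇒≤ 1+k<p)))
    where
    cancel : ∀ e a b → - e * (a + b) + (a * e - + 1) ≡ b * (-1ℤ * e) - + 1
    cancel = solve-∀
    eq : - (-1ℤ ^ k) * + (p C suc k) + (+ (ℕ.pred p C k) * -1ℤ ^ k - + 1)
       ≡ + (ℕ.pred p C suc k) * -1ℤ ^ suc k - + 1
    eq = trans (cong (λ c → - (-1ℤ ^ k) * + c + (+ (ℕ.pred p C k) * -1ℤ ^ k - + 1))
                 (trans (cong (_C suc k) (sym (ℕ.suc-pred p))) (sym (nCk+nC[k+1]≡[n+1]C[k+1] (ℕ.pred p) k))))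
      (cancel (-1ℤ ^ k) (+ (ℕ.pred p C k)) (+ (ℕ.pred p C suc k)))

  sum-δ1 : ∀ n ψ y → ∑[ k ≤ n ] δ 1 ψ (y + + toℕ k) ≡ ψ y - ψ (y + + suc n)
  sum-δ1 zero    ψ y = trans (ℤ.+-identityʳ _) (cong (δ 1 ψ) (ℤ.+-identityʳ y))
  sum-δ1 (suc n) ψ y = begin
    δ 1 ψ (y + + 0) + ∑[ k ≤ n ] δ 1 ψ (y + + suc (toℕ k))
      ≡⟨ cong₂ _+_ (cong (δ 1 ψ) (ℤ.+-identityʳ y))
           (sum-cong-≗ {suc n} (λ k → cong (δ 1 ψ) (sym (ℤ.+-assoc y (+ 1) (+ toℕ k))))) ⟩
    δ 1 ψ y + ∑[ k ≤ n ] δ 1 ψ (y + + 1 + + toℕ k)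
      ≡⟨ cong (_+_ (δ 1 ψ y)) (sum-δ1 n ψ (y + + 1)) ⟩
    δ 1 ψ y + (ψ (y + + 1) - ψ (y + + 1 + + suc n))
      ≡⟨ telescope (ψ y) (ψ (y + + 1)) (ψ (y + + 1 + + suc n)) ⟩
    ψ y - ψ (y + + 1 + + suc n)
      ≡⟨ cong (λ x → ψ y - ψ x) (ℤ.+-assoc y (+ 1) (+ suc n)) ⟩
    ψ y - ψ (y + + suc (suc n)) ∎
    where
    open ≡-Reasoning
    telescope : ∀ a b c → (a - b) + (b - c) ≡ a - c
    telescope = solve-∀

  module _ (ψ : ℤ → ℤ) (periodic : ∀ y → ψ (y + + p) ≡ ψ y) where

    -- The sum telescopes to a difference of two values of `δ m ψ` at distance p, and `δ m ψ`
    -- inherits the period p.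
    δ-period-sum : ∀ m y → ∑[ k ≤ ℕ.pred p ] δ (suc m) ψ (y + + toℕ k) ≡ + 0
    δ-period-sum m y = begin
      ∑[ k ≤ ℕ.pred p ] δ 1 (δ m ψ) (y + + toℕ k)       ≡⟨ sum-δ1 (ℕ.pred p) (δ m ψ) y ⟩
      δ m ψ y - δ m ψ (y + + suc (ℕ.pred p))            ≡⟨ cong (λ q → δ m ψ y - δ m ψ (y + + q)) (ℕ.suc-pred p) ⟩
      δ m ψ y - δ m ψ (y + + p)                         ≡⟨ cong (_-_ (δ m ψ y)) (δ-shift m ψ (+ p) y) ⟨
      δ m ψ y - δ m (λ x → ψ (x + + p)) y               ≡⟨ cong (_-_ (δ m ψ y)) (δ-cong m periodic y) ⟩
      δ m ψ y - δ m ψ y                                 ≡⟨ ℤ.+-inverseʳ (δ m ψ y) ⟩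
      + 0                                               ∎
      where open ≡-Reasoning

    -- In ℤ[x]/(xᵖ - 1), x acting as the shift, (1 - x)ᵖ = (1 - x)((1 - x)ᵖ⁻¹ - (1 + x + ⋯ + xᵖ⁻¹)),
    -- and the last factor is divisible by p.
    fleck-step : ∀ {d} m → (∀ y → d ∣ₚ δ (suc m) ψ y) → ∀ y → + p * d ∣ₚ δ (ℕ.pred p ℕ.+ suc m) ψ y
    fleck-step {d} m d∣θ y = subst (+ p * d ∣ₚ_) (sym eq) (∣ₚ-sum {n = suc (ℕ.pred p)} _ term)
      where
      open ≡-Reasoning
      θ : ℤ → ℤ
      θ = δ (suc m) ψ

      c : ℕ → ℤ
      c k = + (ℕ.pred p C k) * -1ℤ ^ k - + 1

      term : ∀ k → + p * d ∣ₚ c (toℕ k) * θ (y + + toℕ k)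
      term k = *-mono-∣ₚ
        (∣⇒∣ₚ (C[p-1]-alternating (toℕ k) (subst (toℕ k ℕ.<_) (ℕ.suc-pred p) (Fin.toℕ<n k))))
        (d∣θ (y + + toℕ k))

      split : ∀ a e t → a * (e * t) ≡ (a * e - + 1) * t + t
      split = solve-∀

      eq : δ (ℕ.pred p ℕ.+ suc m) ψ y ≡ ∑[ k ≤ ℕ.pred p ] (c (toℕ k) * θ (y + + toℕ k))
      eq = begin
        δ (ℕ.pred p ℕ.+ suc m) ψ y
          ≡⟨ δ-δ (ℕ.pred p) (suc m) ψ y ⟨
        δ (ℕ.pred p) θ y
          ≡⟨ δ-expansion (ℕ.pred p) θ y ⟩
        ∑[ k ≤ ℕ.pred p ] (+ (ℕ.pred p C toℕ k) * (-1ℤ ^ toℕ k * θ (y + + toℕ k)))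
          ≡⟨ sum-cong-≗ {suc (ℕ.pred p)} (λ k → split (+ (ℕ.pred p C toℕ k)) (-1ℤ ^ toℕ k) (θ (y + + toℕ k))) ⟩
        ∑[ k ≤ ℕ.pred p ] (c (toℕ k) * θ (y + + toℕ k) + θ (y + + toℕ k))
          ≡⟨ ∑-distrib-+ {suc (ℕ.pred p)} (λ k → c (toℕ k) * θ (y + + toℕ k)) (λ k → θ (y + + toℕ k)) ⟩
        ∑[ k ≤ ℕ.pred p ] (c (toℕ k) * θ (y + + toℕ k)) + ∑[ k ≤ ℕ.pred p ] θ (y + + toℕ k)
          ≡⟨ cong (_+_ (∑[ k ≤ ℕ.pred p ] (c (toℕ k) * θ (y + + toℕ k)))) (δ-period-sum m y) ⟩
        ∑[ k ≤ ℕ.pred p ] (c (toℕ k) * θ (y + + toℕ k)) + + 0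
          ≡⟨ ℤ.+-identityʳ _ ⟩
        ∑[ k ≤ ℕ.pred p ] (c (toℕ k) * θ (y + + toℕ k)) ∎

    fleck-iterate : ∀ {d} e m → (∀ y → d ∣ₚ δ (suc m) ψ y) → ∀ y → π^ e * d ∣ₚ δ (e ℕ.* ℕ.pred p ℕ.+ suc m) ψ y
    fleck-iterate {d} zero    m d∣θ y = subst (_∣ₚ δ (suc m) ψ y) (sym (ℤ.*-identityˡ d)) (d∣θ y)
    fleck-iterate {d} (suc e) m d∣θ y =
      subst₂ (λ a k → a ∣ₚ δ k ψ y) eq index
        (fleck-step (e ℕ.* ℕ.pred p ℕ.+ m)
          (subst (λ k → ∀ y → π^ e * d ∣ₚ δ k ψ y) (ℕ.+-suc (e ℕ.* ℕ.pred p) m) (fleck-iterate e m d∣θ)) y)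
      where
      eq : + p * (π^ e * d) ≡ π^ (suc e) * d
      eq = trans (sym (ℤ.*-assoc (+ p) (π^ e) d)) (cong (_* d) (sym (ℤ.pos-* p (p ℕ.^ e))))
      index : ℕ.pred p ℕ.+ suc (e ℕ.* ℕ.pred p ℕ.+ m) ≡ suc e ℕ.* ℕ.pred p ℕ.+ suc m
      index = lemma (ℕ.pred p) e m
        where
        lemma : ∀ q e m → q ℕ.+ suc (e ℕ.* q ℕ.+ m) ≡ suc e ℕ.* q ℕ.+ suc m
        lemma = ℕSolver.solve-∀

    -- Let m = ⌊n/p⌋, r = n mod p and n = m(p - 1) + (r + m). By induction m differences give m!, r
    -- more preserve this, and m rounds of p - 1 differences gain p^m; up to a unit, p^m m! is n!. A
    -- round has to start from at least one difference, so m = 0, where n! is a unit, is treated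
    -- apart.
    !∣ₚδ-periodic : ∀ n y → ⟦ n ⟧! ∣ₚ δ n ψ y
    !∣ₚδ-periodic = <-rec _ step
      where
      open ∣ₚ-Reasoning
      digits : ∀ n → n ℕ./ p ℕ.* ℕ.pred p ℕ.+ (n ℕ.% p ℕ.+ n ℕ./ p) ≡ n
      digits n = trans (lemma (n ℕ./ p) (ℕ.pred p) (n ℕ.% p))
        (trans (cong (λ q → n ℕ.% p ℕ.+ n ℕ./ p ℕ.* q) (ℕ.suc-pred p)) (sym (ℕ.m≡m%n+[m/n]*n n p)))
        where
        lemma : ∀ m q r → m ℕ.* q ℕ.+ (r ℕ.+ m) ≡ r ℕ.+ m ℕ.* suc q
        lemma = ℕSolver.solve-∀

      lift : ∀ e m r → suc m ≡ e → (∀ y → ⟦ suc m ⟧! ∣ₚ δ (suc m) ψ y) → ∀ y →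
        π^ e * ⟦ e ⟧! ∣ₚ δ (e ℕ.* ℕ.pred p ℕ.+ (r ℕ.+ e)) ψ y
      lift e m r refl rec y = subst (λ k → π^ e * ⟦ e ⟧! ∣ₚ δ (e ℕ.* ℕ.pred p ℕ.+ k) ψ y) (sym (ℕ.+-suc r m))
        (fleck-iterate e (r ℕ.+ m)
          (subst (λ k → ∀ y → ⟦ e ⟧! ∣ₚ δ k ψ y) (ℕ.+-suc r m)
            (λ y → subst (⟦ e ⟧! ∣ₚ_) (δ-δ r e ψ y) (δ-∣ₚ-everywhere r (δ e ψ) rec y))) y)

      step : ∀ n → (∀ {m} → m ℕ.< n → ∀ y → ⟦ m ⟧! ∣ₚ δ m ψ y) → ∀ y → ⟦ n ⟧! ∣ₚ δ n ψ y
      step n rec y with n ℕ./ p in quot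
      ... | zero = begin
        ⟦ n ⟧!                        ≲⟨ !∣ₚπ^*! n ⟩
        π^ (n ℕ./ p) * ⟦ n ℕ./ p ⟧!   ≡⟨ cong (λ m → π^ m * ⟦ m ⟧!) quot ⟩
        + 1                           ≲⟨ ∣ₚn⇒∣ₚm*n (δ n ψ y) ∣ₚ-refl ⟩
        δ n ψ y * + 1                 ≡⟨ ℤ.*-identityʳ (δ n ψ y) ⟩
        δ n ψ y                       ∎
      ... | suc m = begin
        ⟦ n ⟧!                                                      ≲⟨ !∣ₚπ^*! n ⟩
        π^ (n ℕ./ p) * ⟦ n ℕ./ p ⟧!                                 ≲⟨ lift (n ℕ./ p) m (n ℕ.% p) (sym quot) (rec m+1<n) y ⟩
        δ (n ℕ./ p ℕ.* ℕ.pred p ℕ.+ (n ℕ.% p ℕ.+ n ℕ./ p)) ψ y      ≡⟨ cong (λ k → δ k ψ y) (digits n) ⟩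
        δ n ψ y                                                     ∎
        where
        n≢0 : n ≢ 0
        n≢0 refl = contradiction (trans (sym (ℕ.0/n≡0 p)) quot) λ ()

        m+1<n : suc m ℕ.< n
        m+1<n = subst (ℕ._< n) quot (ℕ.m/n<m n p {{ℕ.≢-nonZero n≢0}} 2≤p)

  -- In the Leibniz rule the term with `δ (suc n) ψ` is divisible already, and in the other one the
  -- factor e(n + 1) turns e^n n! into e^(n+1) (n+1)!. It is used with e = p for α = 0 and with e =
  -- 1 for α = 1.
  !∣ₚδ-leibniz : ∀ e ψ → (∀ n y → + (e ℕ.^ n) * ⟦ n ⟧! ∣ₚ δ n ψ y) →
    ∀ n y → + (e ℕ.^ n) * ⟦ n ⟧! ∣ₚ δ n (λ x → + e * (x * ψ x)) y
  !∣ₚδ-leibniz e ψ ∣δ zero    y = ∣⇒∣ₚ (divides (+ e * (y * ψ y)) (sym (ℤ.*-identityʳ (+ e * (y * ψ y)))))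
  !∣ₚδ-leibniz e ψ ∣δ (suc n) y = subst (+ (e ℕ.^ suc n) * ⟦ suc n ⟧! ∣ₚ_) (sym eq)
      (∣ₚ-- (∣ₚn⇒∣ₚm*n (+ e * y) (∣δ (suc n) y))
            (subst (_∣ₚ + e * + suc n * δ n ψ (y + + 1)) (sym power) (*-monoʳ-∣ₚ (+ e * + suc n) (∣δ n (y + + 1)))))
    where
    regroup : ∀ e y a m b → e * (y * a - m * b) ≡ e * y * a - e * m * b
    regroup = solve-∀
    eq : δ (suc n) (λ x → + e * (x * ψ x)) y ≡ + e * y * δ (suc n) ψ y - + e * + suc n * δ n ψ (y + + 1)
    eq = trans (δ-scale (suc n) (+ e) (λ x → x * ψ x) y)
      (trans (cong (+ e *_) (δ-leibniz n ψ y)) (regroup (+ e) y (δ (suc n) ψ y) (+ suc n) (δ n ψ (y + + 1))))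

    interchange : ∀ a b c d → a * b * (c * d) ≡ a * c * (b * d)
    interchange = solve-∀
    power : + (e ℕ.^ suc n) * ⟦ suc n ⟧! ≡ + e * + suc n * (+ (e ℕ.^ n) * ⟦ n ⟧!)
    power = trans (cong₂ _*_ (ℤ.pos-* e (e ℕ.^ n)) (ℤ.pos-* (suc n) (n !)))
      (interchange (+ e) (+ (e ℕ.^ n)) (+ suc n) ⟦ n ⟧!)

-- Expansion of (1 - E)^(pN) in powers of 1 - E^p and ε.

module DigitExpansion (p : ℕ) (p-prime : Prime p) where
  open import Data.Integer.Base using (_+_; _*_; _-_; -_; _^_; _≤_; _<_)
  open Valuation p p-prime
  open Difference
  open DifferenceDivisibility p p-prime
  open SemiringSum ℤ.+-*-semiring using (sum-syntax; sum⁺-syntax; sum-cong-≗; sum-init-last; *-distribˡ-sum)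

  multiples : (ℤ → ℤ) → ℤ → ℤ
  multiples v x with + p ∣? x
  ... | yes p∣x = v (quotient p∣x)
  ... | no  _   = + 0

  multiples-∣ : ∀ v z → multiples v (z * + p) ≡ v z
  multiples-∣ v z with + p ∣? z * + p
  ... | yes (divides q eq) = cong v (sym (ℤ.*-cancelʳ-≡ z q (+ p) eq))
  ... | no  p∤zp           = contradiction (divides z refl) p∤zp

  multiples-∤ : ∀ v {x} → ¬ (+ p ∣ x) → multiples v x ≡ + 0
  multiples-∤ v {x} p∤x with + p ∣? x
  ... | yes p∣x = contradiction p∣x p∤x
  ... | no  _   = refl

  private
    [1+z]*p : ∀ z q → (z + + 1) * q ≡ z * q + q
    [1+z]*p = solve-∀

  multiples-1-periodic : ∀ c y → multiples (λ _ → c) (y + + p) ≡ multiples (λ _ → c) y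
  multiples-1-periodic c y with + p ∣? y
  ... | yes (divides z refl) = trans (cong (multiples (λ _ → c)) (sym ([1+z]*p z (+ p)))) (multiples-∣ (λ _ → c) (z + + 1))
  ... | no  p∤y = multiples-∤ (λ _ → c) (λ p∣y+p → p∤y (∣m+n∣n⇒∣m p∣y+p ∣-refl))

  -- The powers of 1 - Eᵖ, where E is the shift.
  δᵖ : ℕ → (ℤ → ℤ) → ℤ → ℤ
  δᵖ zero    ψ y = ψ y
  δᵖ (suc j) ψ y = δᵖ j ψ y - δᵖ j ψ (y + + p)

  -- On multiples of p, a shift by p is a shift of the quotient by 1.
  δᵖ-multiples : ∀ j v z → δᵖ j (multiples v) (z * + p) ≡ δ j v z
  δᵖ-multiples zero    v z = multiples-∣ v z
  δᵖ-multiples (suc j) v z = cong₂ _-_ (δᵖ-multiples j v z)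
    (trans (cong (δᵖ j (multiples v)) (sym ([1+z]*p z (+ p)))) (δᵖ-multiples j v (z + + 1)))

  δᵖ-multiples-∤ : ∀ j v {y} → ¬ (+ p ∣ y) → δᵖ j (multiples v) y ≡ + 0
  δᵖ-multiples-∤ zero    v p∤y = multiples-∤ v p∤y
  δᵖ-multiples-∤ (suc j) v p∤y = cong₂ _-_ (δᵖ-multiples-∤ j v p∤y)
    (δᵖ-multiples-∤ j v (λ p∣y+p → p∤y (∣m+n∣n⇒∣m p∣y+p ∣-refl)))

  -- The powers of (1 - E)ᵖ - (1 - Eᵖ).
  ε : ℕ → (ℤ → ℤ) → ℤ → ℤ
  ε zero    ψ y = ψ y
  ε (suc i) ψ y = δ p (ε i ψ) y - (ε i ψ y - ε i ψ (y + + p))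

  ε-- : ∀ i ψ χ y → ε i (λ x → ψ x - χ x) y ≡ ε i ψ y - ε i χ y
  ε-- zero    ψ χ y = refl
  ε-- (suc i) ψ χ y = trans
    (cong₂ _-_ (trans (δ-cong p (ε-- i ψ χ) y) (δ-- p (ε i ψ) (ε i χ) y))
               (cong₂ _-_ (ε-- i ψ χ y) (ε-- i ψ χ (y + + p))))
    (interchange (δ p (ε i ψ) y) (δ p (ε i χ) y) (ε i ψ y) (ε i χ y) (ε i ψ (y + + p)) (ε i χ (y + + p)))
    where
    interchange : ∀ a b c d e f → (a - b) - ((c - d) - (e - f)) ≡ (a - (c - e)) - (b - (d - f))
    interchange = solve-∀

  ε-shift : ∀ i ψ k y → ε i (λ x → ψ (x + k)) y ≡ ε i ψ (y + k)
  ε-shift zero    ψ k y = refl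
  ε-shift (suc i) ψ k y = cong₂ _-_ (trans (δ-cong p (ε-shift i ψ k) y) (δ-shift p (ε i ψ) k y))
    (cong₂ _-_ (ε-shift i ψ k y) (trans (ε-shift i ψ k (y + + p)) (cong (ε i ψ) (swap y (+ p) k))))
    where
    swap : ∀ y j k → y + j + k ≡ y + k + j
    swap = solve-∀

  δ-digit-expansion : ∀ N ψ y → δ (N ℕ.* p) ψ y ≡ ∑[ i ≤ N ] (+ (N C toℕ i) * ε (toℕ i) (δᵖ (N ℕ.∸ toℕ i) ψ) y)
  δ-digit-expansion N ψ y = begin
    δ (N ℕ.* p) ψ y
      ≡⟨ cong (λ j → δ (N ℕ.* p) (δᵖ j ψ) y) (trans (cong (N ℕ.∸_) (ℕ.+-identityʳ N)) (ℕ.n∸n≡0 N)) ⟨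
    w N 0
      ≡⟨ pascal-array N w rule N 0 (ℕ.≤-reflexive (ℕ.+-identityʳ N)) ⟩
    ∑[ i ≤ N ] (+ (N C toℕ i) * w 0 (toℕ i ℕ.+ 0))
      ≡⟨ sum-cong-≗ {suc N} (λ i → cong (λ j → + (N C toℕ i) * w 0 j) (ℕ.+-identityʳ (toℕ i))) ⟩
    ∑[ i ≤ N ] (+ (N C toℕ i) * w 0 (toℕ i)) ∎
    where
    open ≡-Reasoning
    -- The entry is (1 - E)^(pm) ε^i (1 - E^p)^(N - m - i) ψ at y.
    w : ℕ → ℕ → ℤ
    w m i = δ (m ℕ.* p) (ε i (δᵖ (N ℕ.∸ (m ℕ.+ i)) ψ)) y

    rule : ∀ m i → m ℕ.+ i ℕ.< N → w (suc m) i ≡ w m (suc i) + w m i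
    rule m i m+i<N = begin
      δ (p ℕ.+ m ℕ.* p) χ y
        ≡⟨ cong (λ n → δ n χ y) (ℕ.+-comm p (m ℕ.* p)) ⟩
      δ (m ℕ.* p ℕ.+ p) χ y
        ≡⟨ δ-δ (m ℕ.* p) p χ y ⟨
      δ (m ℕ.* p) (δ p χ) y
        ≡⟨ δ-cong (m ℕ.* p) (λ x → split (δ p χ x) (χ x - χ (x + + p))) y ⟩
      δ (m ℕ.* p) (λ x → ε (suc i) θ x + (χ x - χ (x + + p))) y
        ≡⟨ δ-+ (m ℕ.* p) (ε (suc i) θ) (λ x → χ x - χ (x + + p)) y ⟩
      δ (m ℕ.* p) (ε (suc i) θ) y + δ (m ℕ.* p) (λ x → χ x - χ (x + + p)) y
        ≡⟨ cong₂ (λ j b → δ (m ℕ.* p) (ε (suc i) (δᵖ (N ℕ.∸ j) ψ)) y + b) (sym (ℕ.+-suc m i))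
             (δ-cong (m ℕ.* p) commute y) ⟩
      w m (suc i) + δ (m ℕ.* p) (ε i (δᵖ (suc (N ℕ.∸ suc (m ℕ.+ i))) ψ)) y
        -- Since subtraction is truncated, it is m + i < N that makes `N ∸ (m + i)` the successor of
        -- `N ∸ suc (m + i)`.
        ≡⟨ cong (λ j → w m (suc i) + δ (m ℕ.* p) (ε i (δᵖ j ψ)) y) (sym (ℕ.+-∸-assoc 1 m+i<N)) ⟩
      w m (suc i) + w m i ∎
      where
      θ χ : ℤ → ℤ
      θ = δᵖ (N ℕ.∸ (suc m ℕ.+ i)) ψ
      χ = ε i θ

      split : ∀ a b → a ≡ (a - b) + b
      split = solve-∀

      commute : ∀ x → χ x - χ (x + + p) ≡ ε i (δᵖ (suc (N ℕ.∸ suc (m ℕ.+ i))) ψ) x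
      commute x = trans (cong (_-_ (χ x)) (sym (ε-shift i θ (+ p) x))) (sym (ε-- i θ (λ x → θ (x + + p)) x))

  -- The constant terms of (1 - E)^p and 1 - E^p cancel. The coefficients that remain, the middle
  -- binomial coefficients and (-1)^p + 1, are all divisible by p.
  ε₁-expansion : ∀ ψ y → ε 1 ψ y ≡
    ∑[ k < ℕ.pred p ] (+ (p C suc (toℕ k)) * (-1ℤ ^ suc (toℕ k) * ψ (y + + suc (toℕ k))))
      + (-1ℤ ^ p + + 1) * ψ (y + + p)
  ε₁-expansion ψ y = begin
    δ p ψ y - (ψ y - ψ (y + + p))
      ≡⟨ cong (_- (ψ y - ψ (y + + p))) (trans (cong (λ n → δ n ψ y) (sym (ℕ.suc-pred p))) (δ-expansion q+1 ψ y)) ⟩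
    f 0 + ∑[ k < q+1 ] f (suc (toℕ k)) - (ψ y - ψ (y + + p))
      ≡⟨ cong₂ (λ a b → a + b - (ψ y - ψ (y + + p))) first (sum-init-last {q} (λ k → f (suc (toℕ k)))) ⟩
    ψ y + (∑[ k < q ] f (suc (toℕ (Fin.inject₁ k))) + f (suc (toℕ (Fin.fromℕ q)))) - (ψ y - ψ (y + + p))
      ≡⟨ cong₂ (λ a b → ψ y + (a + b) - (ψ y - ψ (y + + p)))
           (sum-cong-≗ {q} (λ k → trans (cong (f ∘ suc) (Fin.toℕ-inject₁ k)) (cong (λ n → + (n C suc (toℕ k)) * (-1ℤ ^ suc (toℕ k) * ψ (y + + suc (toℕ k)))) (ℕ.suc-pred p)))) last ⟩
    ψ y + (m + -1ℤ ^ p * ψ (y + + p)) - (ψ y - ψ (y + + p))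
      ≡⟨ collect (ψ y) m (-1ℤ ^ p) (ψ (y + + p)) ⟩
    m + (-1ℤ ^ p + + 1) * ψ (y + + p) ∎
    where
    open ≡-Reasoning
    q q+1 : ℕ
    q   = ℕ.pred p
    q+1 = suc q

    f : ℕ → ℤ
    f k = + (q+1 C k) * (-1ℤ ^ k * ψ (y + + k))

    m : ℤ
    m = ∑[ k < q ] (+ (p C suc (toℕ k)) * (-1ℤ ^ suc (toℕ k) * ψ (y + + suc (toℕ k))))

    first : f 0 ≡ ψ y
    first = trans (ℤ.*-identityˡ _) (trans (ℤ.*-identityˡ _) (cong ψ (ℤ.+-identityʳ y)))

    last : f (suc (toℕ (Fin.fromℕ q))) ≡ -1ℤ ^ p * ψ (y + + p)
    last = begin
      f (suc (toℕ (Fin.fromℕ q)))             ≡⟨ cong (f ∘ suc) (Fin.toℕ-fromℕ q) ⟩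
      + (q+1 C q+1) * (-1ℤ ^ q+1 * ψ (y + + q+1)) ≡⟨ cong (λ c → + c * (-1ℤ ^ q+1 * ψ (y + + q+1))) (nCn≡1 q+1) ⟩
      + 1 * (-1ℤ ^ q+1 * ψ (y + + q+1))       ≡⟨ ℤ.*-identityˡ _ ⟩
      -1ℤ ^ q+1 * ψ (y + + q+1)               ≡⟨ cong (λ n → -1ℤ ^ n * ψ (y + + n)) (ℕ.suc-pred p) ⟩
      -1ℤ ^ p * ψ (y + + p)                   ∎

    collect : ∀ a m e b → a + (m + e * b) - (a - b) ≡ m + (e + + 1) * b
    collect = solve-∀

  -- From (-1)^(p-1) ≡ 1 modulo p, the case k = p - 1 of `C[p-1]-alternating`; this treats p = 2 and
  -- odd p alike.
  p∣[-1]^p+1 : + p ∣ -1ℤ ^ p + + 1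
  p∣[-1]^p+1 = subst (+ p ∣_) eq (∣n⇒∣m*n -1ℤ (C[p-1]-alternating (ℕ.pred p) (ℕ.≤-reflexive (ℕ.suc-pred p))))
    where
    open ≡-Reasoning
    simplify : ∀ e → -1ℤ * (+ 1 * e - + 1) ≡ -1ℤ * e + + 1
    simplify = solve-∀
    eq : -1ℤ * (+ (ℕ.pred p C ℕ.pred p) * -1ℤ ^ ℕ.pred p - + 1) ≡ -1ℤ ^ p + + 1
    eq = begin
      -1ℤ * (+ (ℕ.pred p C ℕ.pred p) * -1ℤ ^ ℕ.pred p - + 1)
        ≡⟨ cong (λ c → -1ℤ * (+ c * -1ℤ ^ ℕ.pred p - + 1)) (nCn≡1 (ℕ.pred p)) ⟩
      -1ℤ * (+ 1 * -1ℤ ^ ℕ.pred p - + 1)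
        ≡⟨ simplify (-1ℤ ^ ℕ.pred p) ⟩
      -1ℤ ^ suc (ℕ.pred p) + + 1
        ≡⟨ cong (λ n → -1ℤ ^ n + + 1) (ℕ.suc-pred p) ⟩
      -1ℤ ^ p + + 1 ∎

  -- By `ε₁-expansion`, ε^i is p^i times an integer combination of the shifts by 0, ..., ip; the p^i
  -- is moved into the multiplier of ψ.
  ε-∣ₚ : ∀ {d} i z ψ y → (∀ s → s ℕ.≤ i ℕ.* p → d ∣ₚ π^ i * z * ψ (y + + s)) → d ∣ₚ z * ε i ψ y
  ε-∣ₚ {d} zero    z ψ y d∣ = subst (d ∣ₚ_) (cong₂ _*_ (ℤ.*-identityˡ z) (cong ψ (ℤ.+-identityʳ y))) (d∣ 0 ℕ.z≤n)
  ε-∣ₚ {d} (suc i) z ψ y d∣ = subst (d ∣ₚ_) (sym (trans (cong (z *_) (ε₁-expansion χ y)) (ℤ.*-distribˡ-+ z (∑[ k < ℕ.pred p ] t k) _)))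
      (∣ₚ-+ (subst (d ∣ₚ_) (sym (*-distribˡ-sum {ℕ.pred p} z t)) (∣ₚ-sum {n = ℕ.pred p} _ inner))
            (via p∣[-1]^p+1 ℕ.≤-refl))
    where
    χ : ℤ → ℤ
    χ = ε i ψ

    t : Fin (ℕ.pred p) → ℤ
    t k = + (p C suc (toℕ k)) * (-1ℤ ^ suc (toℕ k) * χ (y + + suc (toℕ k)))

    shifted : ∀ s → s ℕ.≤ p → d ∣ₚ + p * z * χ (y + + s)
    shifted s s≤p = ε-∣ₚ i (+ p * z) ψ (y + + s) λ j j≤ip →
      subst (d ∣ₚ_) (cong₂ _*_ scale (cong ψ (sym (ℤ.+-assoc y (+ s) (+ j))))) (d∣ (s ℕ.+ j) (ℕ.+-mono-≤ s≤p j≤ip))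
      where
      regroup : ∀ q u z → q * u * z ≡ u * (q * z)
      regroup = solve-∀
      scale : π^ (suc i) * z ≡ π^ i * (+ p * z)
      scale = trans (cong (_* z) (ℤ.pos-* p (p ℕ.^ i))) (regroup (+ p) (π^ i) z)

    via : ∀ {c s} → + p ∣ c → s ℕ.≤ p → d ∣ₚ z * (c * χ (y + + s))
    via {s = s} (divides b refl) s≤p = subst (d ∣ₚ_) (regroup b (+ p) z (χ (y + + s))) (∣ₚn⇒∣ₚm*n b (shifted s s≤p))
      where
      regroup : ∀ b q z x → b * (q * z * x) ≡ z * (b * q * x)
      regroup = solve-∀

    inner : ∀ k → d ∣ₚ z * t k
    inner k = subst (λ x → d ∣ₚ z * x) (ℤ.*-assoc (+ (p C suc (toℕ k))) (-1ℤ ^ suc (toℕ k)) _)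
      (via {s = suc (toℕ k)} (subst (+ p ∣_) (ℤ.*-comm e (+ (p C suc (toℕ k)))) (∣n⇒∣m*n e (∣ᵤ⇒∣ (p∣pCk ℕ.z<s k+1<p)))) (ℕ.<⇒≤ k+1<p))
      where
      e : ℤ
      e = -1ℤ ^ suc (toℕ k)
      k+1<p : suc (toℕ k) ℕ.< p
      k+1<p = subst (suc (toℕ k) ℕ.<_) (ℕ.suc-pred p) (ℕ.s<s (Fin.toℕ<n k))

-- Sums of floors and Legendre's formula.

module FloorSums (p : ℕ) (p-prime : Prime p) where
  open import Data.Integer.Base using (_+_; _*_; _-_; -_; _≤_; _<_)
  open Valuation p p-prime
  open Difference
  open DifferenceDivisibility p p-prime
  open DigitExpansion p p-prime
  open SemiringSum ℤ.+-*-semiring using (*-distribˡ-sum)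

  infixl 7 _/p^_
  _/p^_ : ℕ → ℕ → ℕ
  n /p^ β = ℕ._/_ n (p ℕ.^ β) {{ℕ.m^n≢0 p β}}

  z*p≤x⇒z≤x/p : ∀ {z x} → z * + p ≤ x → z ≤ x ℤ./ℕ p
  z*p≤x⇒z≤x/p {z} {x} le = subst (z ≤_) (ℤ.pred-suc (x ℤ./ℕ p))
    (ℤ.i<j⇒i≤pred[j] (ℤ.*-cancelʳ-<-nonNeg {z} {ℤ.suc (x ℤ./ℕ p)} (+ p) (ℤ.≤-<-trans le (n<s[n/ℕd]*d x p))))

  /p-mono-≤ : ∀ {x y} → x ≤ y → x ℤ./ℕ p ≤ y ℤ./ℕ p
  /p-mono-≤ {x} x≤y = z*p≤x⇒z≤x/p (ℤ.≤-trans ([n/ℕd]*d≤n x p) x≤y)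

  [x+k*p]/p : ∀ x k → (x + k * + p) ℤ./ℕ p ≡ x ℤ./ℕ p + k
  [x+k*p]/p x k = ℤ.≤-antisym upper (lower x k)
    where
    distrib : ∀ a k q → (a + k) * q ≡ a * q + k * q
    distrib = solve-∀
    lower : ∀ x k → x ℤ./ℕ p + k ≤ (x + k * + p) ℤ./ℕ p
    lower x k = z*p≤x⇒z≤x/p (subst (_≤ x + k * + p) (sym (distrib (x ℤ./ℕ p) k (+ p)))
      (ℤ.+-monoˡ-≤ (k * + p) ([n/ℕd]*d≤n x p)))

    undo : ∀ x k q → x + k * q + - k * q ≡ x
    undo = solve-∀
    undo′ : ∀ a k → a + - k + k ≡ a
    undo′ = solve-∀
    upper : (x + k * + p) ℤ./ℕ p ≤ x ℤ./ℕ p + k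
    upper = subst₂ _≤_ (undo′ _ k) (cong (λ w → w ℤ./ℕ p + k) (undo x k (+ p)))
      (ℤ.+-monoˡ-≤ k (lower (x + k * + p) (- k)))

  -- ⌊x/p⌋ + ⌊x/p²⌋ + ⋯ + ⌊x/pᵝ⌋, also for negative x.
  L : ℕ → ℤ → ℤ
  L zero    x = + 0
  L (suc β) x = x ℤ./ℕ p + L β (x ℤ./ℕ p)

  L-mono-≤ : ∀ β {x y} → x ≤ y → L β x ≤ L β y
  L-mono-≤ zero    _   = ℤ.≤-refl
  L-mono-≤ (suc β) x≤y = ℤ.+-mono-≤ (/p-mono-≤ x≤y) (L-mono-≤ β (/p-mono-≤ x≤y))

  -- Floors are not additive in general, but a p^β can be divided by p up to β times without
  -- remainder, so this summand separates at each stage.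
  L-+ : ∀ β x a → L β (x + a * π^ β) ≡ L β x + L β (a * π^ β)
  L-+ zero    x a = refl
  L-+ (suc β) x a = begin
    (x + a * π^ (suc β)) ℤ./ℕ p + L β ((x + a * π^ (suc β)) ℤ./ℕ p)
      ≡⟨ cong (λ k → k + L β k) (quot x) ⟩
    q + aQ + L β (q + aQ)
      ≡⟨ cong (_+_ (q + aQ)) (L-+ β q a) ⟩
    q + aQ + (L β q + L β aQ)
      ≡⟨ interchange q aQ (L β q) (L β aQ) ⟩
    q + L β q + (aQ + L β aQ)
      ≡⟨ cong (λ k → q + L β q + (k + L β k)) quot₀ ⟨
    L (suc β) x + L (suc β) (a * π^ (suc β)) ∎
    where
    open ≡-Reasoning
    q aQ : ℤ
    q = x ℤ./ℕ p
    aQ = a * π^ β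

    interchange : ∀ a b c d → a + b + (c + d) ≡ a + c + (b + d)
    interchange = solve-∀

    regroup : ∀ a q u → a * (q * u) ≡ a * u * q
    regroup = solve-∀

    quot : ∀ x → (x + a * π^ (suc β)) ℤ./ℕ p ≡ x ℤ./ℕ p + aQ
    quot x = trans (cong (λ k → (x + k) ℤ./ℕ p)
        (trans (cong (a *_) (ℤ.pos-* p (p ℕ.^ β))) (regroup a (+ p) (π^ β))))
      ([x+k*p]/p x aQ)

    quot₀ : (a * π^ (suc β)) ℤ./ℕ p ≡ aQ
    quot₀ = trans (cong (ℤ._/ℕ p) (sym (ℤ.+-identityˡ (a * π^ (suc β)))))
      (trans (quot (+ 0)) (trans (cong (λ k → + k + aQ) (ℕ.0/n≡0 p)) (ℤ.+-identityˡ aQ)))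

  Lℕ : ℕ → ℕ → ℕ
  Lℕ zero    n = 0
  Lℕ (suc β) n = n ℕ./ p ℕ.+ Lℕ β (n ℕ./ p)

  L-pos : ∀ β n → L β (+ n) ≡ + Lℕ β n
  L-pos zero    n = refl
  L-pos (suc β) n = cong (_+_ (+ (n ℕ./ p))) (L-pos β (n ℕ./ p))

  private
    shuffle : ∀ β n → π^ (n ℕ./ p) * (π^ Lℕ β (n ℕ./ p) * ⟦ n ℕ./ p /p^ β ⟧!) ≡
      π^ Lℕ (suc β) n * ⟦ n /p^ suc β ⟧!
    shuffle β n = trans (sym (ℤ.*-assoc (π^ (n ℕ./ p)) (π^ Lℕ β (n ℕ./ p)) _))
      (cong₂ _*_ (sym (π^-+ (n ℕ./ p) (Lℕ β (n ℕ./ p))))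
        (cong ⟦_⟧! (ℕ.m/n/o≡m/[n*o] n p (p ℕ.^ β) {{_}} {{ℕ.m^n≢0 p β}} {{ℕ.m^n≢0 p (suc β)}})))

  -- One half of Legendre's formula stopped after β steps, v(n!) = L β n + v(⌊n/p^β⌋!);
  -- `legendre∣ₚ!` is the other.
  !∣ₚlegendre : ∀ β n → ⟦ n ⟧! ∣ₚ π^ Lℕ β n * ⟦ n /p^ β ⟧!
  !∣ₚlegendre zero    n = ∣ₚ-reflexive (trans (cong ⟦_⟧! (sym (ℕ.n/1≡n n))) (sym (ℤ.*-identityˡ _)))
  !∣ₚlegendre (suc β) n = begin
    ⟦ n ⟧!                                                                   ≲⟨ !∣ₚπ^*! n ⟩
    π^ (n ℕ./ p) * ⟦ n ℕ./ p ⟧!                                              ≲⟨ *-monoʳ-∣ₚ (π^ (n ℕ./ p)) (!∣ₚlegendre β (n ℕ./ p)) ⟩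
    π^ (n ℕ./ p) * (π^ Lℕ β (n ℕ./ p) * ⟦ n ℕ./ p /p^ β ⟧!)            ≡⟨ shuffle β n ⟩
    π^ Lℕ (suc β) n * ⟦ n /p^ suc β ⟧!                                 ∎
    where open ∣ₚ-Reasoning

  legendre∣ₚ! : ∀ β n → π^ Lℕ β n * ⟦ n /p^ β ⟧! ∣ₚ ⟦ n ⟧!
  legendre∣ₚ! zero    n = ∣ₚ-reflexive (trans (ℤ.*-identityˡ _) (cong ⟦_⟧! (ℕ.n/1≡n n)))
  legendre∣ₚ! (suc β) n = begin
    π^ Lℕ (suc β) n * ⟦ n /p^ suc β ⟧!                                 ≡⟨ shuffle β n ⟨
    π^ (n ℕ./ p) * (π^ Lℕ β (n ℕ./ p) * ⟦ n ℕ./ p /p^ β ⟧!)            ≲⟨ *-monoʳ-∣ₚ (π^ (n ℕ./ p)) (legendre∣ₚ! β (n ℕ./ p)) ⟩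
    π^ (n ℕ./ p) * ⟦ n ℕ./ p ⟧!                                              ≲⟨ π^*!∣ₚ! n ⟩
    ⟦ n ⟧!                                                                   ∎
    where open ∣ₚ-Reasoning

  -- v(δ n Φ y) ≥ v(n!) - L β (- y) - L β (n + y); the powers of p are split as c - d because this
  -- bound may be larger or smaller than v(n!).
  Bounded : (ℤ → ℤ) → ℕ → Set
  Bounded Φ β = ∀ n y c d → L β (- y) + L β (+ n + y) + + d ≤ + c → π^ d * ⟦ n ⟧! ∣ₚ π^ c * δ n Φ y

  bounded-zero : ∀ {Φ} → (∀ n y → ⟦ n ⟧! ∣ₚ δ n Φ y) → Bounded Φ 0
  bounded-zero ∣δ n y c d le = *-mono-∣ₚ (π^-mono (ℤ.drop‿+≤+ le)) (∣δ n y)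

  -- The induction step: from Φ to its copy on the multiples of p.

  module _ {Φ : ℤ → ℤ} {β : ℕ} (bounded : Bounded Φ β) (n : ℕ) (y : ℤ) (c d : ℕ)
           (le : L (suc β) (- y) + L (suc β) (+ n + y) + + d ≤ + c) where
    private
      N : ℕ
      N = n ℕ./ p

      R M : ℤ
      R = (- y) ℤ./ℕ p
      M = (+ n + y) ℤ./ℕ p

      +n≡ : + n ≡ + (n ℕ.% p) + + N * + p
      +n≡ = trans (cong +_ (ℕ.m≡m%n+[m/n]*n n p)) (cong (_+_ (+ (n ℕ.% p))) (ℤ.pos-* N p))

      -- This prepares n! for the i-th term of the expansion: C(N, i) is its coefficient and (N -
      -- i)! matches the N - i differences of Φ. It combines v(n!) = N + v(N!), N! = C(N, i) i! (N -
      -- i)! and `!∣ₚπ^[n∸1]` for i!.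
      !∣ₚC*! : ∀ i → i ℕ.≤ N → π^ d * ⟦ n ⟧! ∣ₚ + (N C i) * (π^ (d ℕ.+ (N ℕ.+ (i ℕ.∸ 1))) * ⟦ N ℕ.∸ i ⟧!)
      !∣ₚC*! i i≤N = begin
        π^ d * ⟦ n ⟧!
          ≲⟨ *-monoʳ-∣ₚ (π^ d) (!∣ₚπ^*! n) ⟩
        π^ d * (π^ N * ⟦ N ⟧!)
          ≡⟨ cong (λ f → π^ d * (π^ N * f)) (trans (cong +_ (sym (C*!*! i≤N)))
               (trans (ℤ.pos-* (N C i) _) (cong (+ (N C i) *_) (ℤ.pos-* (i !) _)))) ⟩
        π^ d * (π^ N * (+ (N C i) * (⟦ i ⟧! * ⟦ N ℕ.∸ i ⟧!)))
          ≲⟨ *-monoʳ-∣ₚ (π^ d) (*-monoʳ-∣ₚ (π^ N) (*-monoʳ-∣ₚ (+ (N C i)) (*-monoˡ-∣ₚ ⟦ N ℕ.∸ i ⟧! (!∣ₚπ^[n∸1] i)))) ⟩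
        π^ d * (π^ N * (+ (N C i) * (π^ (i ℕ.∸ 1) * ⟦ N ℕ.∸ i ⟧!)))
          ≡⟨ regroup (π^ d) (π^ N) (+ (N C i)) (π^ (i ℕ.∸ 1)) ⟦ N ℕ.∸ i ⟧! ⟩
        + (N C i) * (π^ d * (π^ N * π^ (i ℕ.∸ 1)) * ⟦ N ℕ.∸ i ⟧!)
          ≡⟨ cong (λ e → + (N C i) * (e * ⟦ N ℕ.∸ i ⟧!))
               (sym (trans (π^-+ d (N ℕ.+ (i ℕ.∸ 1))) (cong (π^ d *_) (π^-+ N (i ℕ.∸ 1))))) ⟩
        + (N C i) * (π^ (d ℕ.+ (N ℕ.+ (i ℕ.∸ 1))) * ⟦ N ℕ.∸ i ⟧!) ∎
        where
        open ∣ₚ-Reasoning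
        regroup : ∀ a b c e f → a * (b * (c * (e * f))) ≡ c * (a * (b * e) * f)
        regroup = solve-∀

      N+[i∸1]≤R+M+i : ∀ i z → - z ≤ R → + (N ℕ.∸ i) + z ≤ M → + (N ℕ.+ (i ℕ.∸ 1)) ≤ R + M + + i
      N+[i∸1]≤R+M+i zero z -z≤R N+z≤M = begin
          + (N ℕ.+ 0)      ≡⟨ cong +_ (ℕ.+-identityʳ N) ⟩
          + N              ≡⟨ cancel (+ N) z ⟩
          - z + (+ N + z)  ≤⟨ ℤ.+-mono-≤ -z≤R N+z≤M ⟩
          R + M            ≡⟨ ℤ.+-identityʳ (R + M) ⟨
          R + M + + 0      ∎
        where
        open ℤ.≤-Reasoning
        cancel : ∀ n z → n ≡ - z + (n + z)
        cancel = solve-∀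
      N+[i∸1]≤R+M+i (suc j) _ _ _ = begin
          + (N ℕ.+ j)            ≤⟨ ℤ.+-monoˡ-≤ (+ j) N≤R+M+1 ⟩
          R + M + + 1 + + j      ≡⟨ ℤ.+-assoc (R + M) (+ 1) (+ j) ⟩
          R + M + + suc j        ∎
        where
        open ℤ.≤-Reasoning
        cancel : ∀ n y → n ≡ - y + (n + y)
        cancel = solve-∀
        regroup : ∀ r m q → (+ 1 + r) * q + (+ 1 + m) * q ≡ (+ 1 + (r + m + + 1)) * q
        regroup = solve-∀

        N*p< : + N * + p < ℤ.suc (R + M + + 1) * + p
        N*p< = begin-strict
          + N * + p                              ≤⟨ ℤ.i≤j+i (+ N * + p) (+ (n ℕ.% p)) ⟩
          + (n ℕ.% p) + + N * + p                ≡⟨ trans (sym +n≡) (cancel (+ n) y) ⟩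
          - y + (+ n + y)                        <⟨ ℤ.+-mono-< (n<s[n/ℕd]*d (- y) p) (n<s[n/ℕd]*d (+ n + y) p) ⟩
          ℤ.suc R * + p + ℤ.suc M * + p          ≡⟨ regroup R M (+ p) ⟩
          ℤ.suc (R + M + + 1) * + p              ∎

        N≤R+M+1 : + N ≤ R + M + + 1
        N≤R+M+1 = subst (+ N ≤_) (ℤ.pred-suc (R + M + + 1)) (ℤ.i<j⇒i≤pred[j] (ℤ.*-cancelʳ-<-nonNeg {+ N} {ℤ.suc (R + M + + 1)} (+ p) N*p<))

      module _ (t s i : ℕ) (z : ℤ) (t≤ : t ℕ.≤ n ℕ.% p) (s≤ : s ℕ.≤ i ℕ.* p) (i≤N : i ℕ.≤ N)
               (eq : y + + t + + s ≡ z * + p) where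

        -z≤R : - z ≤ R
        -z≤R = z*p≤x⇒z≤x/p (subst₂ _≤_ (trans (cong -_ eq) (ℤ.neg-distribˡ-* z (+ p))) refl
          (ℤ.neg-mono-≤ (ℤ.≤-trans (ℤ.i≤i+j y (+ t)) (ℤ.i≤i+j (y + + t) (+ s)))))

        -- From zp, another (N - i)p leads at most to y + (n mod p) + ip + (N - i)p = y + n.
        N∸i+z≤M : + (N ℕ.∸ i) + z ≤ M
        N∸i+z≤M = z*p≤x⇒z≤x/p (begin
          (+ (N ℕ.∸ i) + z) * + p                    ≡⟨ ℤ.*-distribʳ-+ (+ p) (+ (N ℕ.∸ i)) z ⟩
          + (N ℕ.∸ i) * + p + z * + p                ≡⟨ cong (_+_ (+ (N ℕ.∸ i) * + p)) eq ⟨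
          + (N ℕ.∸ i) * + p + (y + + t + + s)        ≤⟨ ℤ.+-monoʳ-≤ (+ (N ℕ.∸ i) * + p)
                                                          (ℤ.+-mono-≤ (ℤ.+-monoʳ-≤ y (ℤ.+≤+ t≤)) (ℤ.+≤+ s≤)) ⟩
          + (N ℕ.∸ i) * + p + (y + + (n ℕ.% p) + + (i ℕ.* p)) ≡⟨ cong (λ k → + (N ℕ.∸ i) * + p + (y + + (n ℕ.% p) + k)) (ℤ.pos-* i p) ⟩
          + (N ℕ.∸ i) * + p + (y + + (n ℕ.% p) + + i * + p)   ≡⟨ regroup (+ (N ℕ.∸ i)) (+ p) y (+ (n ℕ.% p)) (+ i) ⟩
          + (n ℕ.% p) + (+ (N ℕ.∸ i) + + i) * + p + y         ≡⟨ cong (λ k → + (n ℕ.% p) + + k * + p + y) (ℕ.m∸n+n≡m i≤N) ⟩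
          + (n ℕ.% p) + + N * + p + y                         ≡⟨ cong (_+ y) +n≡ ⟨
          + n + y                                    ∎)
          where
          open ℤ.≤-Reasoning
          regroup : ∀ a q y b i → a * q + (y + b + i * q) ≡ b + (a + i) * q + y
          regroup = solve-∀

        -- The condition under which `bounded` applies to N - i differences at z. Monotonicity of
        -- `L β` passes from z to R and M; then R + L β R and M + L β M are the values of
        -- `L (suc β)` in `le`. The i on the right is the p^i gained from ε^i.
        exponents : L β (- z) + L β (+ (N ℕ.∸ i) + z) + + (d ℕ.+ (N ℕ.+ (i ℕ.∸ 1))) ≤ + (i ℕ.+ c)
        exponents = begin
          L β (- z) + L β (+ (N ℕ.∸ i) + z) + (+ d + + (N ℕ.+ (i ℕ.∸ 1)))
            ≤⟨ ℤ.+-mono-≤ (ℤ.+-mono-≤ (L-mono-≤ β -z≤R) (L-mono-≤ β N∸i+z≤M)) (ℤ.+-monoʳ-≤ (+ d) (N+[i∸1]≤R+M+i i z -z≤R N∸i+z≤M)) ⟩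
          L β R + L β M + (+ d + (R + M + + i))
            ≡⟨ regroup (L β R) (L β M) (+ d) R M (+ i) ⟩
          + i + (R + L β R + (M + L β M) + + d)
            ≤⟨ ℤ.+-monoʳ-≤ (+ i) le ⟩
          + i + + c ∎
          where
          open ℤ.≤-Reasoning
          regroup : ∀ a b d r m i → a + b + (d + (r + m + i)) ≡ i + (r + a + (m + b) + d)
          regroup = solve-∀

      -- Points off pℤ contribute 0, and on pℤ the differences in steps of p are differences of Φ.
      leaf : ∀ t s i → t ℕ.≤ n ℕ.% p → s ℕ.≤ i ℕ.* p → i ℕ.≤ N →
        π^ (d ℕ.+ (N ℕ.+ (i ℕ.∸ 1))) * ⟦ N ℕ.∸ i ⟧! ∣ₚ π^ i * π^ c * δᵖ (N ℕ.∸ i) (multiples Φ) (y + + t + + s)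
      leaf t s i t≤ s≤ i≤N with + p ∣? y + + t + + s
      ... | no  p∤x = subst (_ ∣ₚ_) (sym (trans (cong (π^ i * π^ c *_) (δᵖ-multiples-∤ (N ℕ.∸ i) Φ p∤x)) (ℤ.*-zeroʳ (π^ i * π^ c)))) ∣ₚ0
      ... | yes (divides z eq) = subst (_ ∣ₚ_)
        (cong₂ _*_ (π^-+ i c) (trans (sym (δᵖ-multiples (N ℕ.∸ i) Φ z)) (cong (δᵖ (N ℕ.∸ i) (multiples Φ)) (sym eq))))
        (bounded (N ℕ.∸ i) z (i ℕ.+ c) (d ℕ.+ (N ℕ.+ (i ℕ.∸ 1))) (exponents t s i z t≤ s≤ i≤N eq))

      branch : ∀ t → t ℕ.≤ n ℕ.% p → π^ d * ⟦ n ⟧! ∣ₚ π^ c * δ (N ℕ.* p) (multiples Φ) (y + + t)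
      branch t t≤ = subst (π^ d * ⟦ n ⟧! ∣ₚ_)
        (sym (trans (cong (π^ c *_) (δ-digit-expansion N (multiples Φ) (y + + t))) (*-distribˡ-sum {suc N} (π^ c) summand)))
        (∣ₚ-sum {n = suc N} _ λ i → let i≤N = ℕ.s≤s⁻¹ (Fin.toℕ<n i) in
          ∣ₚ-trans (!∣ₚC*! (toℕ i) i≤N)
            (subst (_ ∣ₚ_) (swap (+ (N C toℕ i)) (π^ c) _)
              (*-monoʳ-∣ₚ (+ (N C toℕ i)) (ε-∣ₚ (toℕ i) (π^ c) (δᵖ (N ℕ.∸ toℕ i) (multiples Φ)) (y + + t)
                (λ s s≤ → leaf t s (toℕ i) t≤ s≤ i≤N)))))
        where
        summand : Fin (suc N) → ℤ
        summand i = + (N C toℕ i) * ε (toℕ i) (δᵖ (N ℕ.∸ toℕ i) (multiples Φ)) (y + + t)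
        swap : ∀ a b x → a * (b * x) ≡ b * (a * x)
        swap = solve-∀

    -- Of the n = (n mod p) + Np differences, the Np are expanded in ε, while the n mod p others are
    -- only resolved into shifts by t: they bring no power of p, and v(n!) = N + v(N!) asks for
    -- none.
    bounded-multiples-at : π^ d * ⟦ n ⟧! ∣ₚ π^ c * δ n (multiples Φ) y
    bounded-multiples-at = subst (λ x → π^ d * ⟦ n ⟧! ∣ₚ π^ c * x)
      (trans (δ-δ (n ℕ.% p) (N ℕ.* p) (multiples Φ) y) (cong (λ k → δ k (multiples Φ) y) (sym (ℕ.m≡m%n+[m/n]*n n p))))
      (δ-∣ₚ (π^ c) (n ℕ.% p) (δ (N ℕ.* p) (multiples Φ)) y branch)

  bounded-multiples : ∀ {Φ β} → Bounded Φ β → Bounded (multiples Φ) (suc β)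
  bounded-multiples {β = β} bounded = bounded-multiples-at {β = β} bounded

-- The denominator divides the differences.

module DenominatorDivisibility (p : ℕ) (p-prime : Prime p) where
  open import Data.Integer.Base using (_+_; _*_; _-_; -_; _^_)
  open Valuation p p-prime
  open Difference
  open DifferenceDivisibility p p-prime
  open DigitExpansion p p-prime
  open FloorSums p p-prime
  open PrimePower p p-prime

  module _ (β ρ σ n : ℕ) (A B : ℤ) (ρ<Q : ρ ℕ.< p ℕ.^ β) (σ<Q : σ ℕ.< p ℕ.^ β)
           (n≡ : + n ≡ (+ ρ + A * π^ β) + (+ σ + B * π^ β))
           (c d : ℕ) (c≡ : L β (+ ρ + A * π^ β) + L β (+ σ + B * π^ β) + + d ≡ + c) where
    private
      Q : ℕ
      Q = p ℕ.^ β

      N : ℤ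
      N = ⟦ n /p^ β ⟧!

      instance
        Q-nonZero : ℕ.NonZero Q
        Q-nonZero = ℕ.m^n≢0 p β

      -- By `L-+` the multiples A p^β and B p^β contribute the same to L β n as to c, and cancel.
      exponent : Lℕ β (ρ ℕ.+ σ) ℕ.+ c ≡ d ℕ.+ (Lℕ β n ℕ.+ (Lℕ β ρ ℕ.+ Lℕ β σ))
      exponent = ℤ.+-injective (begin
        + Lℕ β (ρ ℕ.+ σ) + + c
          ≡⟨ cong₂ _+_ (L-pos β (ρ ℕ.+ σ)) c≡ ⟨
        s + (L β (+ ρ + A * π^ β) + L β (+ σ + B * π^ β) + + d)
          ≡⟨ cong₂ (λ a b → s + (a + b + + d)) (L-+ β (+ ρ) A) (L-+ β (+ σ) B) ⟩
        s + (L β (+ ρ) + a + (L β (+ σ) + b) + + d)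
          ≡⟨ regroup s (L β (+ ρ)) a (L β (+ σ)) b (+ d) ⟩
        + d + (s + (a + b) + (L β (+ ρ) + L β (+ σ)))
          ≡⟨ cong (λ l → + d + (l + (L β (+ ρ) + L β (+ σ)))) Ln≡ ⟨
        + d + (L β (+ n) + (L β (+ ρ) + L β (+ σ)))
          ≡⟨ cong (_+_ (+ d)) (cong₂ _+_ (L-pos β n) (cong₂ _+_ (L-pos β ρ) (L-pos β σ))) ⟩
        + (d ℕ.+ (Lℕ β n ℕ.+ (Lℕ β ρ ℕ.+ Lℕ β σ))) ∎)
        where
        open ≡-Reasoning
        s a b : ℤ
        s = L β (+ (ρ ℕ.+ σ))
        a = L β (A * π^ β)
        b = L β (B * π^ β)

        regroup : ∀ s r a t b d → s + (r + a + (t + b) + d) ≡ d + (s + (a + b) + (r + t))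
        regroup = solve-∀
        collect : ∀ r t a b q → (r + a * q) + (t + b * q) ≡ (r + t) + b * q + a * q
        collect = solve-∀
        Ln≡ : L β (+ n) ≡ s + (a + b)
        Ln≡ = begin
          L β (+ n)                                       ≡⟨ cong (L β) (trans n≡ (collect (+ ρ) (+ σ) A B (π^ β))) ⟩
          L β (+ (ρ ℕ.+ σ) + B * π^ β + A * π^ β)         ≡⟨ L-+ β (+ (ρ ℕ.+ σ) + B * π^ β) A ⟩
          L β (+ (ρ ℕ.+ σ) + B * π^ β) + a                ≡⟨ cong (_+ a) (L-+ β (+ (ρ ℕ.+ σ)) B) ⟩
          s + b + a                                       ≡⟨ trans (ℤ.+-assoc s b a) (cong (_+_ s) (ℤ.+-comm b a)) ⟩
          s + (a + b)                                     ∎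

      quotient-small : ∀ {m} → m ℕ.< Q → ⟦ m /p^ β ⟧! ≡ + 1
      quotient-small m<Q = cong ⟦_⟧! (ℕ.m<n⇒m/n≡0 m<Q)

      small∣ₚ! : ∀ {m} → m ℕ.< Q → π^ Lℕ β m ∣ₚ ⟦ m ⟧!
      small∣ₚ! {m} m<Q = subst (_∣ₚ ⟦ m ⟧!)
        (trans (cong (π^ Lℕ β m *_) (quotient-small m<Q)) (ℤ.*-identityʳ (π^ Lℕ β m))) (legendre∣ₚ! β m)

      quotient-≤1 : ∀ k → k ℕ.< 2 → ⟦ k ⟧! ≡ + 1
      quotient-≤1 zero          _ = refl
      quotient-≤1 (suc zero)    _ = refl
      quotient-≤1 (suc (suc k)) (ℕ.s<s (ℕ.s<s ()))

      -- As ρ + σ < 2p^β, the factorial left over in Legendre's formula is 0! or 1!.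
      !∣ₚπ^L : ⟦ ρ ℕ.+ σ ⟧! ∣ₚ π^ Lℕ β (ρ ℕ.+ σ)
      !∣ₚπ^L = subst (⟦ ρ ℕ.+ σ ⟧! ∣ₚ_)
        (trans (cong (π^ Lℕ β (ρ ℕ.+ σ) *_) (quotient-≤1 _ quot<2)) (ℤ.*-identityʳ _))
        (!∣ₚlegendre β (ρ ℕ.+ σ))
        where
        quot<2 : (ρ ℕ.+ σ) /p^ β ℕ.< 2
        quot<2 = ℕ.m<n*o⇒m/o<n (subst (ρ ℕ.+ σ ℕ.<_) (cong (Q ℕ.+_) (sym (ℕ.+-identityʳ Q))) (ℕ.+-mono-< ρ<Q σ<Q))

      C! : + ((ρ ℕ.+ σ) C ρ) * (⟦ ρ ⟧! * ⟦ σ ⟧!) ≡ ⟦ ρ ℕ.+ σ ⟧!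
      C! = trans (cong (+ ((ρ ℕ.+ σ) C ρ) *_) (sym (ℤ.pos-* (ρ !) (σ !))))
        (trans (sym (ℤ.pos-* ((ρ ℕ.+ σ) C ρ) _))
          (cong +_ (subst (λ m → ((ρ ℕ.+ σ) C ρ) ℕ.* (ρ ! ℕ.* m !) ≡ (ρ ℕ.+ σ) !) (ℕ.m+n∸m≡n ρ σ) (C*!*! (ℕ.m≤m+n ρ σ)))))

      -- The factor ρ! σ! turns the binomial coefficient into (ρ + σ)!. By Legendre's formula, with
      -- ρ and σ below p^β, both sides become powers of p times ⌊n/p^β⌋!, and `exponent` equates the
      -- powers.
      scaled : ⟦ ρ ⟧! * ⟦ σ ⟧! * (N * + ((ρ ℕ.+ σ) C ρ) * π^ c) ∣ₚ ⟦ ρ ⟧! * ⟦ σ ⟧! * (π^ d * ⟦ n ⟧!)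
      scaled = begin
        ⟦ ρ ⟧! * ⟦ σ ⟧! * (N * + ((ρ ℕ.+ σ) C ρ) * π^ c)
          ≡⟨ regroup ⟦ ρ ⟧! ⟦ σ ⟧! N (+ ((ρ ℕ.+ σ) C ρ)) (π^ c) ⟩
        N * (+ ((ρ ℕ.+ σ) C ρ) * (⟦ ρ ⟧! * ⟦ σ ⟧!) * π^ c)
          ≡⟨ cong (λ f → N * (f * π^ c)) C! ⟩
        N * (⟦ ρ ℕ.+ σ ⟧! * π^ c)
          ≲⟨ *-monoʳ-∣ₚ N (*-monoˡ-∣ₚ (π^ c) !∣ₚπ^L) ⟩
        N * (π^ Lℕ β (ρ ℕ.+ σ) * π^ c)
          ≡⟨ cong (N *_) (trans (sym (π^-+ (Lℕ β (ρ ℕ.+ σ)) c)) (cong π^_ exponent)) ⟩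
        N * π^ (d ℕ.+ (Lℕ β n ℕ.+ (Lℕ β ρ ℕ.+ Lℕ β σ)))
          ≡⟨ cong (N *_) (trans (π^-+ d _) (cong (π^ d *_) (trans (π^-+ (Lℕ β n) _) (cong (π^ Lℕ β n *_) (π^-+ (Lℕ β ρ) (Lℕ β σ)))))) ⟩
        N * (π^ d * (π^ Lℕ β n * (π^ Lℕ β ρ * π^ Lℕ β σ)))
          ≡⟨ regroup′ N (π^ d) (π^ Lℕ β n) (π^ Lℕ β ρ) (π^ Lℕ β σ) ⟩
        π^ Lℕ β ρ * π^ Lℕ β σ * (π^ d * (π^ Lℕ β n * N))
          ≲⟨ *-mono-∣ₚ (*-mono-∣ₚ (small∣ₚ! ρ<Q) (small∣ₚ! σ<Q)) (*-monoʳ-∣ₚ (π^ d) (legendre∣ₚ! β n)) ⟩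
        ⟦ ρ ⟧! * ⟦ σ ⟧! * (π^ d * ⟦ n ⟧!) ∎
        where
        open ∣ₚ-Reasoning
        regroup : ∀ r s m b e → r * s * (m * b * e) ≡ m * (b * (r * s) * e)
        regroup = solve-∀
        regroup′ : ∀ m d l r s → m * (d * (l * (r * s))) ≡ r * s * (d * (l * m))
        regroup′ = solve-∀

    denominator∣ₚ : N * + ((ρ ℕ.+ σ) C ρ) * π^ c ∣ₚ π^ d * ⟦ n ⟧!
    denominator∣ₚ = *-cancelˡ-∣ₚ (⟦ ρ ⟧! * ⟦ σ ⟧!)
      {{subst ℤ.NonZero (ℤ.pos-* (ρ !) (σ !)) (ℕ._!*_!≢0 ρ σ)}} scaled

  -- At y = -r the bound is v(n!) - L β r - L β (n - r), and by `denominator∣ₚ` the valuation of the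
  -- denominator does not exceed it.
  Bounded⇒∣ₚ : ∀ {Φ β} → Bounded Φ β → ∀ n r →
    ⟦ ⌊ n /p^[ suc β -1]⌋ ⟧! * + ((⟨ r ⟩p^[ suc β -1] ℕ.+ ⟨ + n - r ⟩p^[ suc β -1]) C ⟨ r ⟩p^[ suc β -1]) ∣ₚ δ n Φ (- r)
  Bounded⇒∣ₚ {Φ} {β} bounded n r = conclude (L β r + L β (+ n - r)) refl
    where
    instance
      Q-nonZero : ℕ.NonZero (p ℕ.^ β)
      Q-nonZero = ℕ.m^n≢0 p β

    ρ σ : ℕ
    ρ = ⟨ r ⟩p^[ suc β -1]
    σ = ⟨ + n - r ⟩p^[ suc β -1]

    D : ℤ
    D = ⟦ ⌊ n /p^[ suc β -1]⌋ ⟧! * + ((ρ ℕ.+ σ) C ρ)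

    A B : ℤ
    A = r ℤ./ℕ (p ℕ.^ β)
    B = (+ n - r) ℤ./ℕ (p ℕ.^ β)

    r≡ : r ≡ + ρ + A * π^ β
    r≡ = a≡a%ℕn+[a/ℕn]*n r (p ℕ.^ β)

    n-r≡ : + n - r ≡ + σ + B * π^ β
    n-r≡ = a≡a%ℕn+[a/ℕn]*n (+ n - r) (p ℕ.^ β)

    n≡ : + n ≡ (+ ρ + A * π^ β) + (+ σ + B * π^ β)
    n≡ = trans (split (+ n) r) (cong₂ _+_ r≡ n-r≡)
      where
      split : ∀ n r → n ≡ r + (n - r)
      split = solve-∀

    balance : ∀ c d → L β r + L β (+ n - r) + + d ≡ + c → D ∣ₚ δ n Φ (- r)
    balance c d eq = *-cancelˡ-∣ₚ (π^ c) {{ℕ.m^n≢0 p c}}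
      (∣ₚ-trans (subst (_∣ₚ π^ d * ⟦ n ⟧!) (ℤ.*-comm D (π^ c))
          (denominator∣ₚ β ρ σ n A B (n%ℕd<d r (p ℕ.^ β)) (n%ℕd<d (+ n - r) (p ℕ.^ β)) n≡ c d
            (trans (cong₂ (λ x y → L β x + L β y + + d) (sym r≡) (sym n-r≡)) eq)))
        (bounded n (- r) c d (ℤ.≤-reflexive (trans (cong (λ x → L β x + L β (+ n - r) + + d) (ℤ.neg-involutive r)) eq))))

    -- A nonnegative sum is taken as c with d = 0, a negative one as -d with c = 0.
    conclude : ∀ e → L β r + L β (+ n - r) ≡ e → D ∣ₚ δ n Φ (- r)
    conclude (+ m)       eq = balance m 0 (trans (ℤ.+-identityʳ _) eq)
    conclude ℤ.-[1+ m ] eq = balance 0 (suc m) (trans (cong (_+ + suc m) eq) (ℤ.+-inverseˡ (+ suc m)))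

  -- For v = `monomial j` this is φ_α.
  spread : ℕ → (ℤ → ℤ) → ℤ → ℤ
  spread zero    v = v
  spread (suc α) v = multiples (spread α v)

  spread-∣ : ∀ α v z → spread α v (z * π^ α) ≡ v z
  spread-∣ zero    v z = cong v (ℤ.*-identityʳ z)
  spread-∣ (suc α) v z = begin
    multiples (spread α v) (z * π^ (suc α))
      ≡⟨ cong (multiples (spread α v)) (trans (cong (z *_) (ℤ.pos-* p (p ℕ.^ α))) (regroup z (+ p) (π^ α))) ⟩
    multiples (spread α v) (z * π^ α * + p)
      ≡⟨ multiples-∣ (spread α v) (z * π^ α) ⟩
    spread α v (z * π^ α)
      ≡⟨ spread-∣ α v z ⟩
    v z ∎
    where
    open ≡-Reasoning
    regroup : ∀ a q u → a * (q * u) ≡ a * u * q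
    regroup = solve-∀

  spread-∤ : ∀ α v {x} → ¬ (π^ α ∣ x) → spread α v x ≡ + 0
  spread-∤ zero    v {x} ∤x = contradiction (divides x (sym (ℤ.*-identityʳ x))) ∤x
  spread-∤ (suc α) v {x} ∤x with + p ∣? x
  ... | no  _                = refl
  ... | yes (divides z refl) = spread-∤ α v λ π^α∣z → ∤x
    (subst (_∣ z * + p) (trans (ℤ.*-comm (π^ α) (+ p)) (sym (ℤ.pos-* p (p ℕ.^ α)))) (*-mono-∣ π^α∣z ∣-refl))

  -- With p inside the power, `multiples (monomial j)` is x^j on pℤ, so that raising j multiplies it
  -- by x; each degree uses up one factor of p^l.
  monomial : ℕ → ℤ → ℤ
  monomial j x = (+ p * x) ^ j

  δ-cong-∣ₚ : ∀ {d} n {ψ χ} → (∀ x → ψ x ≡ χ x) → ∀ y → d ∣ₚ δ n ψ y → d ∣ₚ δ n χ y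
  δ-cong-∣ₚ {d} n ψ≗χ y = subst (d ∣ₚ_) (δ-cong n ψ≗χ y)

  π^*!∣ₚδ-monomial : ∀ j n y → π^ n * ⟦ n ⟧! ∣ₚ δ n (monomial j) y
  π^*!∣ₚδ-monomial zero    zero    y = ∣ₚ-refl
  π^*!∣ₚδ-monomial zero    (suc n) y = subst (_ ∣ₚ_) (sym (δ-const n (+ 1) y)) ∣ₚ0
  π^*!∣ₚδ-monomial (suc j) n       y = δ-cong-∣ₚ n (λ x → sym (ℤ.*-assoc (+ p) x (monomial j x))) y
    (!∣ₚδ-leibniz p (monomial j) (π^*!∣ₚδ-monomial j) n y)

  -- For j = 0 the function is the indicator of pℤ, which has period p; every further power is a
  -- multiplication by x, hence the Leibniz rule with e = 1.
  !∣ₚδ-multiples-monomial : ∀ j n y → ⟦ n ⟧! ∣ₚ δ n (multiples (monomial j)) y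
  !∣ₚδ-multiples-monomial zero    n y = !∣ₚδ-periodic (multiples (λ _ → + 1)) (multiples-1-periodic (+ 1)) n y
  !∣ₚδ-multiples-monomial (suc j) n y = δ-cong-∣ₚ n step y
    (subst (_∣ₚ δ n (λ x → + 1 * (x * multiples (monomial j) x)) y) (1^ n) (!∣ₚδ-leibniz 1 (multiples (monomial j))
      (λ n y → subst (_∣ₚ δ n (multiples (monomial j)) y) (sym (1^ n)) (!∣ₚδ-multiples-monomial j n y)) n y))
    where
    1^ : ∀ n → + (1 ℕ.^ n) * ⟦ n ⟧! ≡ ⟦ n ⟧!
    1^ n = trans (cong (λ e → + e * ⟦ n ⟧!) (ℕ.^-zeroˡ n)) (ℤ.*-identityˡ ⟦ n ⟧!)

    step : ∀ x → + 1 * (x * multiples (monomial j) x) ≡ multiples (monomial (suc j)) x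
    step x with + p ∣? x
    ... | no  _                = trans (ℤ.*-identityˡ _) (ℤ.*-zeroʳ x)
    ... | yes (divides z refl) = trans (ℤ.*-identityˡ _) (cong (_* monomial j z) (ℤ.*-comm z (+ p)))

  bounded-spread : ∀ j β → Bounded (spread (suc β) (monomial j)) β
  bounded-spread j zero    = bounded-zero (!∣ₚδ-multiples-monomial j)
  bounded-spread j (suc β) = bounded-multiples {β = β} (bounded-spread j β)

  denominator∣ₚδ : ∀ α j n r →
    ⟦ ⌊ n /p^[ α -1]⌋ ⟧! * + ((⟨ r ⟩p^[ α -1] ℕ.+ ⟨ + n - r ⟩p^[ α -1]) C ⟨ r ⟩p^[ α -1]) ∣ₚ δ n (spread α (monomial j)) (- r)
  denominator∣ₚδ (suc β) j n r = Bounded⇒∣ₚ {β = β} (bounded-spread j β) n r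
  -- For the modulus 1/p both remainders are 0, so the binomial coefficient is 1.
  denominator∣ₚδ zero    j n r = begin
    ⟦ p ℕ.* n ⟧! * + 1                             ≡⟨ ℤ.*-identityʳ _ ⟩
    ⟦ p ℕ.* n ⟧!                                   ≲⟨ !∣ₚπ^*! (p ℕ.* n) ⟩
    π^ (p ℕ.* n ℕ./ p) * ⟦ p ℕ.* n ℕ./ p ⟧!        ≡⟨ cong (λ m → π^ m * ⟦ m ⟧!) (trans (cong (ℕ._/ p) (ℕ.*-comm p n)) (ℕ.m*n/n≡m n p)) ⟩
    π^ n * ⟦ n ⟧!                                  ≲⟨ π^*!∣ₚδ-monomial j n (- r) ⟩
    δ n (monomial j) (- r)                         ∎
    where open ∣ₚ-Reasoning

-- Inverses of integers prime to p in ℤₚ.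

module PAdicUnits (p : ℕ) (p-prime : Prime p) where
  open import Data.Integer.Base using (_^_)
  open Valuation p p-prime
  open PAdic p

  approx-≡⇒≈ : ∀ {x y} → (∀ n → approx x n ≡ approx y n) → x ≈ y
  approx-≡⇒≈ {x} {y} eq = mk≈ λ n →
    divides (+ 0) (trans (cong (ℤ._- approx y n) (eq n)) (ℤ.+-inverseʳ (approx y n)))

  bézout : ∀ {u} → p ℕ.∤ u → ∃[ s ] ∃[ t ] s ℤ.* + u ≡ + 1 ℤ.- t ℤ.* + p
  bézout {u} p∤u with coprime-Bézout coprime
    where
    coprime : Coprime u p
    coprime (d∣u , d∣p) with prime⇒irreducible p-prime d∣p
    ... | inj₁ d≡1  = d≡1
    ... | inj₂ refl = contradiction d∣u p∤u
  ... | Bézout.+- x y eq = + x , ℤ.- + y ,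
      trans (sym (ℤ.pos-* x u)) (trans (cong +_ (sym eq)) (trans (cong (ℤ._+_ (+ 1)) (ℤ.pos-* y p)) (lemma (+ y) (+ p))))
    where
    lemma : ∀ y p → + 1 ℤ.+ y ℤ.* p ≡ + 1 ℤ.- (ℤ.- y) ℤ.* p
    lemma = solve-∀
  ... | Bézout.-+ x y eq = ℤ.- + x , + y ,
      trans (lemma (+ x) (+ u)) (cong (ℤ._-_ (+ 1)) (trans (cong (ℤ._+_ (+ 1)) (sym (ℤ.pos-* x u))) (trans (cong +_ eq) (ℤ.pos-* y p))))
    where
    lemma : ∀ x u → (ℤ.- x) ℤ.* u ≡ + 1 ℤ.- (+ 1 ℤ.+ x ℤ.* u)
    lemma = solve-∀

  -- With s u = 1 - t p, the inverse of u is the geometric series s Σ (t p)ⁱ.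
  module _ (u : ℕ) (s t : ℤ) (su≡1-tp : s ℤ.* + u ≡ + 1 ℤ.- t ℤ.* + p) where
    private
      geometric : ℕ → ℤ
      geometric zero    = + 0
      geometric (suc n) = geometric n ℤ.+ s ℤ.* (t ℤ.* + p) ^ n

      π^∣[tp]^ : ∀ n → π^ n ∣ (t ℤ.* + p) ^ n
      π^∣[tp]^ zero    = divides (+ 1) refl
      π^∣[tp]^ (suc n) = subst (_∣ (t ℤ.* + p) ^ suc n) (sym (ℤ.pos-* p (p ℕ.^ n)))
        (*-mono-∣ (divides t refl) (π^∣[tp]^ n))

    inverse : ℤₚ
    inverse = mkℤₚ geometric λ n → subst (π^ n ∣_) (sym (cancel (geometric n) (s ℤ.* (t ℤ.* + p) ^ n)))
        (∣n⇒∣m*n s (π^∣[tp]^ n))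
      where
      cancel : ∀ a b → a ℤ.+ b ℤ.- a ≡ b
      cancel = solve-∀

    u*geometric : ∀ n → + u ℤ.* geometric n ≡ + 1 ℤ.- (t ℤ.* + p) ^ n
    u*geometric zero    = ℤ.*-zeroʳ (+ u)
    u*geometric (suc n) = begin
      + u ℤ.* (geometric n ℤ.+ s ℤ.* e)                    ≡⟨ expand (+ u) (geometric n) s e ⟩
      + u ℤ.* geometric n ℤ.+ s ℤ.* + u ℤ.* e              ≡⟨ cong₂ (λ a b → a ℤ.+ b ℤ.* e) (u*geometric n) su≡1-tp ⟩
      + 1 ℤ.- e ℤ.+ (+ 1 ℤ.- t ℤ.* + p) ℤ.* e              ≡⟨ collapse (t ℤ.* + p) e ⟩
      + 1 ℤ.- t ℤ.* + p ℤ.* e                              ∎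
      where
      open ≡-Reasoning
      e : ℤ
      e = (t ℤ.* + p) ^ n
      expand : ∀ u g s e → u ℤ.* (g ℤ.+ s ℤ.* e) ≡ u ℤ.* g ℤ.+ s ℤ.* u ℤ.* e
      expand = solve-∀
      collapse : ∀ b e → + 1 ℤ.- e ℤ.+ (+ 1 ℤ.- b) ℤ.* e ≡ + 1 ℤ.- b ℤ.* e
      collapse = solve-∀

    -- From u x = w d the quotient of x by d is w/u; the n-th approximation is off by -x (tp)^n, a
    -- multiple of p^n.
    divide : ∀ {d x w} → + u ℤ.* x ≡ w ℤ.* d → fromℤ d * (fromℤ w * inverse) ≈ fromℤ x
    divide {d} {x} {w} ux≡wd = mk≈ λ n → subst (π^ n ∣_) (sym (eq n)) (∣n⇒∣m*n (ℤ.- x) (π^∣[tp]^ n))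
      where
      open ≡-Reasoning
      left : ∀ d w g x → d ℤ.* (w ℤ.* g) ℤ.- x ≡ w ℤ.* d ℤ.* g ℤ.- x
      left = solve-∀
      middle : ∀ u x g → u ℤ.* x ℤ.* g ℤ.- x ≡ x ℤ.* (u ℤ.* g) ℤ.- x
      middle = solve-∀
      right : ∀ x e → x ℤ.* (+ 1 ℤ.- e) ℤ.- x ≡ (ℤ.- x) ℤ.* e
      right = solve-∀
      eq : ∀ n → d ℤ.* (w ℤ.* geometric n) ℤ.- x ≡ (ℤ.- x) ℤ.* (t ℤ.* + p) ^ n
      eq n = begin
        d ℤ.* (w ℤ.* geometric n) ℤ.- x            ≡⟨ left d w (geometric n) x ⟩
        w ℤ.* d ℤ.* geometric n ℤ.- x              ≡⟨ cong (λ k → k ℤ.* geometric n ℤ.- x) ux≡wd ⟨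
        + u ℤ.* x ℤ.* geometric n ℤ.- x            ≡⟨ middle (+ u) x (geometric n) ⟩
        x ℤ.* (+ u ℤ.* geometric n) ℤ.- x          ≡⟨ cong (λ k → x ℤ.* k ℤ.- x) (u*geometric n) ⟩
        x ℤ.* (+ 1 ℤ.- (t ℤ.* + p) ^ n) ℤ.- x      ≡⟨ right x _ ⟩
        (ℤ.- x) ℤ.* (t ℤ.* + p) ^ n                ∎

  abstract
    ∣ₚ⇒∃ : ∀ {d x} → d ∣ₚ x → Σ[ a ∈ ℤₚ ] fromℤ d * a ≈ fromℤ x
    ∣ₚ⇒∃ {d} {x} (mk∣ₚ u p∤u (divides w ux≡wd)) =
      let s , t , eq = bézout p∤u in fromℤ w * inverse u s t eq , divide u s t eq {d} {x} {w} ux≡wd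


-- The integer coefficients of the sum.

module Weight (p : ℕ) (p-prime : Prime p) (α : ℕ) (r : ℤ) where
  open PrimePower p p-prime

  weight : ℕ → ℕ → ℤ
  weight n k = + (n C k) ℤ.* (-1ℤ ℤ.^ k) ℤ.* + (⌊ k /p^[ α -1]⌋ !)
    ℤ.* + ((⟨ r ⟩p^[ α -1] ℕ.+ ⟨ + k ℤ.- r ⟩p^[ α -1]) C ⟨ r ⟩p^[ α -1])

  -- A copy that does not unfold: conversion checking would otherwise expand the products.
  abstract
    weightᵃ : ℕ → ℕ → ℤ
    weightᵃ = weight

    weight≡ : ∀ n k → weight n k ≡ weightᵃ n k
    weight≡ n k = refl

-- Functions represented by such sums, over a ring to which ℤ maps.

module Representation (p : ℕ) (p-prime : Prime p) (α : ℕ) (r : ℤ)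
  (R : CommutativeRing 0ℓ 0ℓ)
  (ι : ℤ → CommutativeRing.Carrier R)
  (ι-0 : CommutativeRing._≈_ R (ι (+ 0)) (CommutativeRing.0# R))
  (ι-1 : CommutativeRing._≈_ R (ι (+ 1)) (CommutativeRing.1# R))
  (ι-+ : ∀ a b → CommutativeRing._≈_ R (ι (a ℤ.+ b)) (CommutativeRing._+_ R (ι a) (ι b)))
  (ι-* : ∀ a b → CommutativeRing._≈_ R (ι (a ℤ.* b)) (CommutativeRing._*_ R (ι a) (ι b)))
  (ι-∣ₚ : ∀ {d x} → Valuation._∣ₚ_ p p-prime d x →
    Σ[ a ∈ CommutativeRing.Carrier R ] CommutativeRing._≈_ R (CommutativeRing._*_ R (ι d) a) (ι x))
  where
  open Valuation p p-prime using (π^_; ⟦_⟧!)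
  open Difference using (δ; δ-inversion)
  open DenominatorDivisibility p p-prime using (spread; spread-∣; spread-∤; monomial; denominator∣ₚδ)
  open PrimePower p p-prime
  open Weight p p-prime α r
  open CommutativeRing R hiding (zero) renaming (refl to ≈-refl; sym to ≈-sym; trans to ≈-trans; setoid to ≈-setoid)
  open SemiringSum semiring using (sum; sum⁺-syntax; sum-cong-≋; ∑-distrib-+; *-distribˡ-sum)
  open import Algebra.Solver.Ring.NaturalCoefficients.Default commutativeSemiring using (solve; _:=_; _:+_; _:*_)
  open SetoidReasoning ≈-setoid
  private
    module ℤ-Sum = SemiringSum ℤ.+-*-semiring

  transform : (ℕ → Carrier) → ℕ → Carrier
  transform a n = ∑[ i ≤ n ] (ι (weightᵃ n (toℕ i)) * a (toℕ i))

  transform-+ : ∀ a b n → transform (λ k → a k + b k) n ≈ transform a n + transform b n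
  transform-+ a b n = ≈-trans
    (sum-cong-≋ {suc n} (λ i → distribˡ (ι (weightᵃ n (toℕ i))) (a (toℕ i)) (b (toℕ i))))
    (∑-distrib-+ {suc n} (λ i → ι (weightᵃ n (toℕ i)) * a (toℕ i)) (λ i → ι (weightᵃ n (toℕ i)) * b (toℕ i)))

  transform-* : ∀ c a n → transform (λ k → c * a k) n ≈ c * transform a n
  transform-* c a n = ≈-trans
    (sum-cong-≋ {suc n} (λ i → solve 3 (λ w c x → w :* (c :* x) := c :* (w :* x)) ≈-refl (ι (weightᵃ n (toℕ i))) c (a (toℕ i))))
    (≈-sym (*-distribˡ-sum {suc n} c (λ i → ι (weightᵃ n (toℕ i)) * a (toℕ i))))

  -- The quotient (n - r)/p^α enters as a variable z with an equation, so that one statement serves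
  -- every witness of divisibility.
  Represents : (ℕ → Carrier) → (ℤ → Carrier) → Set
  Represents a v = ∀ n →
    (∀ z → + n ℤ.- r ≡ z ℤ.* π^ α → transform a n ≈ v z) ×
    (¬ (π^ α ∣ + n ℤ.- r) → transform a n ≈ 0#)

  Representable : (ℤ → Carrier) → Set
  Representable v = Σ[ a ∈ (ℕ → Carrier) ] Represents a v

  representable-cong : ∀ {v w} → (∀ z → v z ≈ w z) → Representable v → Representable w
  representable-cong v≈w (a , rep) = a , λ n →
    (λ z eq → ≈-trans (proj₁ (rep n) z eq) (v≈w z)) , proj₂ (rep n)

  representable-+ : ∀ {v w} → Representable v → Representable w → Representable (λ z → v z + w z)
  representable-+ (a , rep-a) (b , rep-b) = (λ k → a k + b k) , λ n →
    (λ z eq → ≈-trans (transform-+ a b n) (+-cong (proj₁ (rep-a n) z eq) (proj₁ (rep-b n) z eq))) ,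
    (λ ∤ → ≈-trans (transform-+ a b n) (≈-trans (+-cong (proj₂ (rep-a n) ∤) (proj₂ (rep-b n) ∤)) (+-identityˡ 0#)))

  representable-* : ∀ c {v} → Representable v → Representable (λ z → c * v z)
  representable-* c (a , rep) = (λ k → c * a k) , λ n →
    (λ z eq → ≈-trans (transform-* c a n) (*-congˡ (proj₁ (rep n) z eq))) ,
    (λ ∤ → ≈-trans (transform-* c a n) (≈-trans (*-congˡ (proj₂ (rep n) ∤)) (zeroʳ c)))

  ι-sum : ∀ {n} (t : Fin n → ℤ) → ι (ℤ-Sum.sum t) ≈ sum (λ i → ι (t i))
  ι-sum {zero}  t = ι-0
  ι-sum {suc n} t = ≈-trans (ι-+ (t Fin.zero) (ℤ-Sum.sum (t ∘ Fin.suc))) (+-congˡ (ι-sum (t ∘ Fin.suc)))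

  -- Binomial inversion turns the representation of φ into divisibility of its differences.
  representable-monomial : ∀ j → Representable (λ z → ι (monomial j z))
  representable-monomial j = a , λ n →
    (λ z eq → ≈-trans (transform-a n) (reflexive (cong ι (trans (cong φ eq) (spread-∣ α (monomial j) z))))) ,
    (λ ∤ → ≈-trans (transform-a n) (≈-trans (reflexive (cong ι (spread-∤ α (monomial j) ∤))) ι-0))
    where
    φ : ℤ → ℤ
    φ = spread α (monomial j)

    b F B : ℕ → ℤ
    b k = δ k φ (ℤ.- r)
    F k = ⟦ ⌊ k /p^[ α -1]⌋ ⟧!
    B k = + ((⟨ r ⟩p^[ α -1] ℕ.+ ⟨ + k ℤ.- r ⟩p^[ α -1]) C ⟨ r ⟩p^[ α -1])

    -- Apart from C(n, k) and the sign, the weight is the denominator; dividing `b k` by it makes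
    -- every term of the transform a term of `δ-inversion`.
    a : ℕ → Carrier
    a k = proj₁ (ι-∣ₚ (denominator∣ₚδ α j k r))

    term : ∀ n k → ι (weightᵃ n k) * a k ≈ ι (+ (n C k) ℤ.* (-1ℤ ℤ.^ k ℤ.* b k))
    term n k = begin
      ι (weightᵃ n k) * a k                   ≈⟨ *-congʳ (reflexive (cong ι (sym (weight≡ n k)))) ⟩
      ι (c ℤ.* e ℤ.* F k ℤ.* B k) * a k      ≈⟨ *-congʳ (≈-trans (reflexive (cong ι (ℤ.*-assoc (c ℤ.* e) (F k) (B k)))) (ι-* (c ℤ.* e) (F k ℤ.* B k))) ⟩
      ι (c ℤ.* e) * ι (F k ℤ.* B k) * a k    ≈⟨ *-assoc _ _ _ ⟩
      ι (c ℤ.* e) * (ι (F k ℤ.* B k) * a k)  ≈⟨ *-congˡ (proj₂ (ι-∣ₚ (denominator∣ₚδ α j k r))) ⟩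
      ι (c ℤ.* e) * ι (b k)                  ≈⟨ ι-* (c ℤ.* e) (b k) ⟨
      ι (c ℤ.* e ℤ.* b k)                    ≈⟨ reflexive (cong ι (ℤ.*-assoc c e (b k))) ⟩
      ι (c ℤ.* (e ℤ.* b k))                  ∎
      where
      c e : ℤ
      c = + (n C k)
      e = -1ℤ ℤ.^ k

    transform-a : ∀ n → transform a n ≈ ι (φ (+ n ℤ.- r))
    transform-a n = begin
      transform a n                                       ≈⟨ sum-cong-≋ {suc n} (λ i → term n (toℕ i)) ⟩
      sum (λ i → ι (s i))                                 ≈⟨ ι-sum s ⟨
      ι (ℤ-Sum.sum s)                                     ≈⟨ reflexive (cong ι (δ-inversion n φ (ℤ.- r))) ⟨
      ι (φ (ℤ.- r ℤ.+ + n))                               ≈⟨ reflexive (cong (ι ∘ φ) (ℤ.+-comm (ℤ.- r) (+ n))) ⟩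
      ι (φ (+ n ℤ.- r))                                   ∎
      where
      s : Fin (suc n) → ℤ
      s i = + (n C toℕ i) ℤ.* (-1ℤ ℤ.^ toℕ i ℤ.* b (toℕ i))

  eval : List Carrier → Carrier → Carrier
  eval f x = foldr (λ c v → c + x * v) 0# f

  eval-zero : ∀ {f} → All (_≈ 0#) f → ∀ x → eval f x ≈ 0#
  eval-zero []          x = ≈-refl
  eval-zero (c≈0 ∷ f≈0) x = ≈-trans (+-cong c≈0 (≈-trans (*-congˡ (eval-zero f≈0 x)) (zeroʳ x))) (+-identityˡ 0#)

  -- The factor monomial j absorbs the powers of z = (n - r)/pᵅ split off from f one at a time,
  -- each together with one factor p of pˡ.
  representable-polynomial : ∀ f l j → All (_≈ 0#) (drop (suc l) f) →
    Representable (λ z → ι (π^ l) * eval f (ι z) * ι (monomial j z))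
  representable-polynomial [] l j _ = representable-cong
    (λ z → ≈-trans (zeroˡ _) (≈-sym (≈-trans (*-congʳ (zeroʳ _)) (zeroˡ _))))
    (representable-* 0# (representable-monomial j))
  -- For l = 0 all coefficients after c vanish, and the polynomial is the constant c.
  representable-polynomial (c ∷ f) zero j f≈0 = representable-cong
    (λ z → *-congʳ (begin
      c                                  ≈⟨ +-identityʳ c ⟨
      c + 0#                             ≈⟨ +-congˡ (≈-trans (*-congˡ (eval-zero f≈0 (ι z))) (zeroʳ (ι z))) ⟨
      c + ι z * eval f (ι z)             ≈⟨ *-identityˡ _ ⟨
      1# * (c + ι z * eval f (ι z))      ≈⟨ *-congʳ ι-1 ⟨
      ι (+ 1) * (c + ι z * eval f (ι z)) ∎))
    (representable-* c (representable-monomial j))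
  representable-polynomial (c ∷ f) (suc l) j f≈0 = representable-cong
    (λ z → begin
      ι (+ p) * ι (π^ l) * c * ι (monomial j z) + ι (π^ l) * eval f (ι z) * ι (monomial (suc j) z)
        ≈⟨ +-congˡ (*-congˡ (≈-trans (ι-* (+ p ℤ.* z) (monomial j z)) (*-congʳ (ι-* (+ p) z)))) ⟩
      ι (+ p) * ι (π^ l) * c * ι (monomial j z) + ι (π^ l) * eval f (ι z) * (ι (+ p) * ι z * ι (monomial j z))
        ≈⟨ solve 6 (λ q u c m e z → q :* u :* c :* m :+ u :* e :* (q :* z :* m) := q :* u :* (c :+ z :* e) :* m) ≈-refl
             (ι (+ p)) (ι (π^ l)) c (ι (monomial j z)) (eval f (ι z)) (ι z) ⟩
      ι (+ p) * ι (π^ l) * (c + ι z * eval f (ι z)) * ι (monomial j z)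
        ≈⟨ *-congʳ (*-congʳ (≈-trans (reflexive (cong ι (ℤ.pos-* p (p ℕ.^ l)))) (ι-* (+ p) (π^ l)))) ⟨
      ι (π^ (suc l)) * (c + ι z * eval f (ι z)) * ι (monomial j z) ∎)
    (representable-+ (representable-* (ι (+ p) * ι (π^ l) * c) (representable-monomial j))
                     (representable-polynomial f l (suc j) f≈0))

-- Specialisation to ℤₚ and passage to approximations.

module PAdicRepresentation (p : ℕ) (p-prime : Prime p) (α : ℕ) (r : ℤ) where
  open PAdic p
  open PAdicUnits p p-prime
  open Weight p p-prime α r
  open Representation p p-prime α r ℤₚ-commutativeRing fromℤ
    (approx-≡⇒≈ (λ _ → refl)) (approx-≡⇒≈ (λ _ → refl)) (λ _ _ → approx-≡⇒≈ (λ _ → refl)) (λ _ _ → approx-≡⇒≈ (λ _ → refl)) ∣ₚ⇒∃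
    using (Representable; transform; representable-cong; representable-polynomial)

  all-coeff : ∀ f → (∀ i → coeff f i ≈ 0#) → All (_≈ 0#) f
  all-coeff []      _   = []
  all-coeff (c ∷ f) f≈0 = f≈0 0 ∷ all-coeff f (f≈0 ∘ suc)

  all-coeff-above : ∀ f l → (∀ i → l ℕ.< i → coeff f i ≈ 0#) → All (_≈ 0#) (drop (suc l) f)
  all-coeff-above []      l       _   = []
  all-coeff-above (c ∷ f) zero    f≈0 = all-coeff f (λ i → f≈0 (suc i) ℕ.z<s)
  all-coeff-above (c ∷ f) (suc l) f≈0 = all-coeff-above f l (λ i l<i → f≈0 (suc i) (ℕ.s<s l<i))

  private
    module ℤ-Sum = SemiringSum ℤ.+-*-semiring

  weighted-sum : (ℕ → ℤₚ) → ℕ → ℕ → ℤ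
  weighted-sum a n m = ℤ-Sum.sum {suc n} (λ i → weightᵃ n (toℕ i) ℤ.* approx (a (toℕ i)) m)

  horner : Polynomial → ℤ → ℕ → ℤ
  horner f z m = foldr (λ c v → approx c m ℤ.+ z ℤ.* v) (+ 0) f

  approx-foldr : ∀ m {op : ℤₚ → ℤₚ → ℤₚ} {o : ℤₚ} →
    (∀ x y → approx (op x y) m ≡ approx x m ℤ.+ approx y m) → approx o m ≡ + 0 →
    ∀ n {s : Fin n → ℤₚ} {t : Fin n → ℤ} → (∀ i → approx (s i) m ≡ t i) →
    approx (Vector.foldr op o s) m ≡ ℤ-Sum.sum t
  approx-foldr m op≡ o≡ zero        s≡t = o≡
  approx-foldr m op≡ o≡ (suc n) {s} s≡t = trans (op≡ (s Fin.zero) _)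
    (cong₂ ℤ._+_ (s≡t Fin.zero) (approx-foldr m op≡ o≡ n (s≡t ∘ Fin.suc)))

  -- Definitional equality in ℤₚ compares coherence proofs, whose normal forms are huge.  The sum
  -- and the evaluation in the theorem are therefore matched one approximation at a time.
  approx-sum : ∀ a n m {i₀} {op : ℤₚ → ℤₚ → ℤₚ} {o : ℤₚ} {s : Fin n → ℤₚ} →
    (∀ x y → approx (op x y) m ≡ approx x m ℤ.+ approx y m) → approx o m ≡ + 0 →
    i₀ ≡ weightᵃ n 0 ℤ.* approx (a 0) m →
    (∀ i → approx (s i) m ≡ weightᵃ n (suc (toℕ i)) ℤ.* approx (a (suc (toℕ i))) m) →
    i₀ ℤ.+ approx (Vector.foldr op o s) m ≡ weighted-sum a n m
  approx-sum a n m op≡ o≡ i₀≡ s≡ = cong₂ ℤ._+_ i₀≡ (approx-foldr m op≡ o≡ n s≡)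

  approx-eval : ∀ {op : ℤₚ → ℤₚ → ℤₚ} {o : ℤₚ} f z m →
    (∀ c v → approx (op c v) m ≡ approx c m ℤ.+ z ℤ.* approx v m) → approx o m ≡ + 0 →
    approx (foldr op o f) m ≡ horner f z m
  approx-eval []      z m op≡ o≡ = o≡
  approx-eval {op} {o} (c ∷ f) z m op≡ o≡ = trans (op≡ c (foldr op o f))
    (cong (λ v → approx c m ℤ.+ z ℤ.* v) (approx-eval {op} {o} f z m op≡ o≡))

  approx-transform : ∀ a n m → approx (transform a n) m ≡ weighted-sum a n m
  approx-transform a n m = approx-sum a n m (λ _ _ → refl) refl refl (λ _ → refl)

  representable-of-degree : ∀ f l → HasDegree f l → Representable (λ z → fromℤ (+ (p ℕ.^ l)) * eval f (fromℤ z))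
  representable-of-degree f l (_ , f≈0) = representable-cong
    -- The splitting starts at j = 0, where the monomial is the constant 1.
    (λ z → approx-≡⇒≈ λ m → ℤ.*-identityʳ (+ (p ℕ.^ l) ℤ.* approx (eval f (fromℤ z)) m))
    (representable-polynomial f l 0 (all-coeff-above f l f≈0))

  abstract
    solution : ∀ f l → HasDegree f l → ℕ → ℤₚ
    solution f l deg = proj₁ (representable-of-degree f l deg)

    solution-∣ : ∀ f l deg n m z → + n ℤ.- r ≡ z ℤ.* + (p ℕ.^ α) →
      + (p ℕ.^ m) ∣ weighted-sum (solution f l deg) n m ℤ.- + (p ℕ.^ l) ℤ.* horner f z m
    solution-∣ f l deg n m z eq = subst₂ (λ x y → + (p ℕ.^ m) ∣ x ℤ.- + (p ℕ.^ l) ℤ.* y)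
      (approx-transform (solution f l deg) n m) (approx-eval f z m (λ _ _ → refl) refl)
      (congruent (proj₁ (proj₂ (representable-of-degree f l deg) n) z eq) m)

    solution-∤ : ∀ f l deg n m → ¬ (+ (p ℕ.^ α) ∣ + n ℤ.- r) →
      + (p ℕ.^ m) ∣ weighted-sum (solution f l deg) n m ℤ.- + 0
    solution-∤ f l deg n m ∤ = subst (λ x → + (p ℕ.^ m) ∣ x ℤ.- + 0)
      (approx-transform (solution f l deg) n m) (congruent (proj₂ (proj₂ (representable-of-degree f l deg) n) ∤) m)

  from-approx : ∀ {P A B x y : ℤ} → A ≡ x → B ≡ y → P ∣ x ℤ.- y → P ∣ A ℤ.- B
  from-approx refl refl q = q

theorem1p4 : (p : ℕ) (p-prime : Prime p) (α : ℕ) (r : ℤ) →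
    let open PAdic p
        open PrimePower p p-prime
    in
    (f : Polynomial) (l : ℕ) → HasDegree f l →
    Σ[ a ∈ (ℕ → ℤₚ) ] ∀ (n : ℕ) →
      let lhs = ∑[ i ≤ n ]
                  (let k = toℕ i in
                   fromℤ (+ (n C k) ℤ.* (-1ℤ ℤ.^ k) ℤ.* + (⌊ k /p^[ α -1]⌋ !)
                          ℤ.* + ((⟨ r ⟩p^[ α -1] ℕ.+ ⟨ + k ℤ.- r ⟩p^[ α -1]) C ⟨ r ⟩p^[ α -1]))
                   * a k)
      in
      ((d : + (p ℕ.^ α) ∣ + n ℤ.- r) →
         lhs ≈ fromℤ (+ (p ℕ.^ l)) * eval f (fromℤ (quotient d)))
      × (¬ (+ (p ℕ.^ α) ∣ + n ℤ.- r) → lhs ≈ 0#)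
theorem1p4 p p-prime α r f l deg = a , λ n →
    (λ d → mk≈ λ m → from-approx (lhs≡ n m)
      (cong (+ (p ℕ.^ l) ℤ.*_) (approx-eval f (quotient d) m (λ _ _ → refl) refl))
      (solution-∣ f l deg n m (quotient d) (_∣_.equality d))) ,
    (λ ∤ → mk≈ λ m → from-approx {B = + 0} (lhs≡ n m) refl (solution-∤ f l deg n m ∤))
  where
  open PAdic p
  open Weight p p-prime α r
  open PAdicRepresentation p p-prime α r
  a = solution f l deg
  -- The sum over i ≤ n always has a term k = 0, which is passed separately as `i₀`; the remaining n
  -- terms form the family.
  lhs≡ = λ n m → approx-sum a n m {i₀ = weight n 0 ℤ.* approx (a 0) m} (λ _ _ → refl) refl
    (cong (ℤ._* approx (a 0) m) (weight≡ n 0))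
    (λ i → cong (ℤ._* approx (a (suc (toℕ i))) m) (weight≡ n (suc (toℕ i))))
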